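{- For each real constant $c>0$ and each integer $m>0$ there is an integer $n>m$ such that $\phi(n)\geq \left(\frac{2}{9}-c\right)n$.
   Context: Let $A$ be a finite alphabet with at least two letters. A word $w\in A^*$ is rich if it contains exactly $|w|+1$ distinct palindromic factors (contiguous subwords), including the empty word $\epsilon$. Let $R$ be the set of all rich words over $A$. A rich word $w$ can be extended in at least two ways if there are two distinct letters $x,y\in A$ such that $wx,wy\in R$. For $w\in R$, let $K(w)$ be the set of all words $u\in A^*$ such that $wu\in R$ and $wu$ can be extended in at least two ways (so $\epsilon\in K(w)$ if $w$ can be extended in at least two ways). Let $\omega(w)=\min\{|u| \mid u\in K(w)\}$, and for $n>0$ let $\phi(n)=\max\{\omega(w)\mid w\in R,\ |w|=n\}$. -}

module Defs where

open import Data.Nat.Base as ℕ using (ℕ; suc)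
import Data.Nat.Properties as ℕ
open import Data.Integer.Base using (+_)
open import Data.Rational.Base
open import Data.Rational.Properties
open import Data.Rational.Solver using (module +-*-Solver)
open import Data.List.Base using (List; length; reverse; _++_; _∷ʳ_)
open import Data.List.Membership.Propositional using (_∈_)
open import Data.List.Relation.Binary.Infix.Heterogeneous using (Infix)
open import Data.List.Relation.Unary.Unique.Propositional using (Unique)
open import Data.Product.Base using (∃-syntax; _×_; _,_)
open import Function.Bundles using (_⇔_)
open import Relation.Binary.PropositionalEquality
  using (_≡_; _≢_; refl; sym; trans; cong)

-- Real numbers: Cauchy sequences of rationals.  There is no quotient;
-- the order relations below do not depend on the representative.

Cauchy : (ℕ → ℚ) → Set
Cauchy s = ∀ ε → 0ℚ < ε →
  ∃[ N ] (∀ i j → N ℕ.≤ i → N ℕ.≤ j → ∣ s i - s j ∣ ≤ ε)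

record ℝ : Set where
  constructor mkℝ
  field
    seq    : ℕ → ℚ
    cauchy : Cauchy seq

open ℝ public

fromℚ : ℚ → ℝ
fromℚ q = mkℝ (λ _ → q) λ ε 0<ε → 0 , λ _ _ _ _ →
  ≤-trans (≤-reflexive (cong ∣_∣ (+-inverseʳ q))) (<⇒≤ 0<ε)

fromℕ : ℕ → ℝ
fromℕ n = fromℚ (+ n / 1)

0ℝ : ℝ
0ℝ = fromℚ 0ℚ

private
  half-pos : ∀ {ε} → 0ℚ < ε → 0ℚ < ε * ½
  half-pos {ε} 0<ε = positive⁻¹ (ε * ½) {{pos*pos⇒pos ε {{positive 0<ε}} ½}}

  halves : ∀ ε → ε * ½ + ε * ½ ≡ ε
  halves ε = trans (sym (*-distribˡ-+ ε ½ ½)) (*-identityʳ ε)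

  sub-sub : ∀ a b a′ b′ → (a - b) - (a′ - b′) ≡ (a - a′) - (b - b′)
  sub-sub = solve 4 (λ a b a′ b′ → (a :- b) :- (a′ :- b′) := (a :- a′) :- (b :- b′)) refl
    where open +-*-Solver

  mul-sub : ∀ a b a′ b′ → a * b - a′ * b′ ≡ a * (b - b′) + b′ * (a - a′)
  mul-sub = solve 4 (λ a b a′ b′ → a :* b :- a′ :* b′ := a :* (b :- b′) :+ b′ :* (a :- a′)) refl
    where open +-*-Solver

  sub-add : ∀ a b → (a - b) + b ≡ a
  sub-add = solve 2 (λ a b → (a :- b) :+ b := a) refl
    where open +-*-Solver

  abs-mul-≤ : ∀ a b {c d} → ∣ a ∣ ≤ c → ∣ b ∣ ≤ d → ∣ a * b ∣ ≤ c * d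
  abs-mul-≤ a b {c} {d} a≤c b≤d =
    ≤-trans (≤-reflexive (∣p*q∣≡∣p∣*∣q∣ a b))
    (≤-trans (*-monoʳ-≤-nonNeg ∣ b ∣ {{∣-∣-nonNeg b}} a≤c)
             (*-monoˡ-≤-nonNeg c {{nonNegative (≤-trans (0≤∣p∣ a) a≤c)}} b≤d))

  bounded : (x : ℝ) → ∃[ B ] (0ℚ < B × ∃[ N ] (∀ i → N ℕ.≤ i → ∣ seq x i ∣ ≤ B))
  bounded x with cauchy x 1ℚ (positive⁻¹ 1ℚ)
  ... | N , h = 1ℚ + ∣ seq x N ∣
              , positive⁻¹ _ {{pos+nonNeg⇒pos 1ℚ ∣ seq x N ∣ {{∣-∣-nonNeg (seq x N)}}}}
              , N , λ i N≤i →
    ≤-trans (≤-reflexive (cong ∣_∣ (sym (sub-add (seq x i) (seq x N)))))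
    (≤-trans (∣p+q∣≤∣p∣+∣q∣ (seq x i - seq x N) (seq x N))
             (+-monoˡ-≤ ∣ seq x N ∣ (h i N N≤i ℕ.≤-refl)))

infixl 6 _-ℝ_
infixl 7 _*ℝ_
infix  4 _<ℝ_ _≤ℝ_

_-ℝ_ : ℝ → ℝ → ℝ
x -ℝ y = mkℝ (λ i → seq x i - seq y i) λ ε 0<ε →
  let N₁ , h₁ = cauchy x (ε * ½) (half-pos 0<ε)
      N₂ , h₂ = cauchy y (ε * ½) (half-pos 0<ε)
  in N₁ ℕ.⊔ N₂ , λ i j N≤i N≤j →
    ≤-trans (≤-reflexive (cong ∣_∣ (sub-sub (seq x i) (seq y i) (seq x j) (seq y j))))
    (≤-trans (∣p-q∣≤∣p∣+∣q∣ (seq x i - seq x j) (seq y i - seq y j))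
    (≤-trans (+-mono-≤ (h₁ i j (ℕ.m⊔n≤o⇒m≤o N₁ N₂ N≤i) (ℕ.m⊔n≤o⇒m≤o N₁ N₂ N≤j))
                       (h₂ i j (ℕ.m⊔n≤o⇒n≤o N₁ N₂ N≤i) (ℕ.m⊔n≤o⇒n≤o N₁ N₂ N≤j)))
             (≤-reflexive (halves ε))))

_*ℝ_ : ℝ → ℝ → ℝ
x *ℝ y = mkℝ (λ i → seq x i * seq y i) λ ε 0<ε →
  let B , 0<B , N₁ , b = bounded x
      C , 0<C , N₂ , c = bounded y
      M = B + C
      instance
        M-pos : Positive M
        M-pos = pos+pos⇒pos B {{positive 0<B}} C {{positive 0<C}}
        M-nonZero : NonZero M
        M-nonZero = pos⇒nonZero M
      δ = 1/ M * ε
      0<δ : 0ℚ < δ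
      0<δ = positive⁻¹ δ {{pos*pos⇒pos (1/ M) {{1/pos⇒pos M}} ε {{positive 0<ε}}}}
      Mδ≡ε : B * δ + C * δ ≡ ε
      Mδ≡ε = trans (sym (*-distribʳ-+ δ B C))
             (trans (sym (*-assoc M (1/ M) ε))
             (trans (cong (_* ε) (*-inverseʳ M)) (*-identityˡ ε)))
      N₃ , h₃ = cauchy x δ 0<δ
      N₄ , h₄ = cauchy y δ 0<δ
      P = N₁ ℕ.⊔ N₂
      Q = N₃ ℕ.⊔ N₄
  in P ℕ.⊔ Q , λ i j N≤i N≤j →
    let P≤i = ℕ.m⊔n≤o⇒m≤o P Q N≤i
        P≤j = ℕ.m⊔n≤o⇒m≤o P Q N≤j
        Q≤i = ℕ.m⊔n≤o⇒n≤o P Q N≤i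
        Q≤j = ℕ.m⊔n≤o⇒n≤o P Q N≤j
        xi = seq x i ; xj = seq x j
        yi = seq y i ; yj = seq y j
    in
    ≤-trans (≤-reflexive (cong ∣_∣ (mul-sub xi yi xj yj)))
    (≤-trans (∣p+q∣≤∣p∣+∣q∣ (xi * (yi - yj)) (yj * (xi - xj)))
    (≤-trans (+-mono-≤
        (abs-mul-≤ xi (yi - yj) (b i (ℕ.m⊔n≤o⇒m≤o N₁ N₂ P≤i))
          (h₄ i j (ℕ.m⊔n≤o⇒n≤o N₃ N₄ Q≤i) (ℕ.m⊔n≤o⇒n≤o N₃ N₄ Q≤j)))
        (abs-mul-≤ yj (xi - xj) (c j (ℕ.m⊔n≤o⇒n≤o N₁ N₂ P≤j))
          (h₃ i j (ℕ.m⊔n≤o⇒m≤o N₃ N₄ Q≤i) (ℕ.m⊔n≤o⇒m≤o N₃ N₄ Q≤j))))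
      (≤-reflexive Mδ≡ε)))

_<ℝ_ : ℝ → ℝ → Set
x <ℝ y = ∃[ ε ] (0ℚ < ε × ∃[ N ] (∀ i → N ℕ.≤ i → seq x i + ε ≤ seq y i))

_≤ℝ_ : ℝ → ℝ → Set
x ≤ℝ y = ∀ ε → 0ℚ < ε → ∃[ N ] (∀ i → N ℕ.≤ i → seq x i ≤ seq y i + ε)

IsMin : (ℕ → Set) → ℕ → Set
IsMin S m = S m × (∀ k → S k → m ℕ.≤ k)

IsMax : (ℕ → Set) → ℕ → Set
IsMax S m = S m × (∀ k → S k → k ℕ.≤ m)

module _ {A : Set} where

  Palindrome : List A → Set
  Palindrome v = reverse v ≡ v

  Factor : List A → List A → Set
  Factor v w = Infix _≡_ v w

  -- The duplicate-free list ps enumerates the set of palindromic factors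
  -- of w, so its length is the cardinality of that set.
  Rich : List A → Set
  Rich w = ∃[ ps ] ( Unique ps
                   × (∀ v → v ∈ ps ⇔ (Palindrome v × Factor v w))
                   × length ps ≡ suc (length w))

  ExtendableInTwoWays : List A → Set
  ExtendableInTwoWays w =
    ∃[ x ] ∃[ y ] (x ≢ y × Rich (w ∷ʳ x) × Rich (w ∷ʳ y))

  K : List A → List A → Set
  K w u = Rich (w ++ u) × ExtendableInTwoWays (w ++ u)

  -- ω w k means ω(w) = k.
  ω : List A → ℕ → Set
  ω w = IsMin (λ k → ∃[ u ] (K w u × length u ≡ k))

-- φ A n p means φ(n) = p over the alphabet A.  The first component says
-- that every ω(w) occurring in the maximum is defined, i.e. that K(w) has
-- a shortest element, so that no w is silently left out.
φ : (A : Set) → ℕ → ℕ → Set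
φ A n p =
    (∀ (w : List A) → Rich w → length w ≡ n → ∃[ k ] ω w k)
  × IsMax (λ k → ∃[ w ] (Rich {A} w × length w ≡ n × ω w k)) p

{-# OPTIONS --safe #-}
module Submission where

open import Defs
open import Data.Nat.Base using (ℕ; _<_; _≤_)
open import Data.Integer.Base using (+_)
open import Data.Rational.Base using (_/_)
open import Data.Fin.Base using (Fin)
open import Data.Product.Base using (∃-syntax; _×_)
open import Function.Bundles using (_↔_)

open import Data.Bool.Base using (Bool; true; false; not)
import Data.Bool.Properties as 𝔹
open import Data.Empty using (⊥; ⊥-elim)
open import Data.Fin.Base using (zero; suc)
import Data.Fin.Properties as Fin
import Data.Integer.Base as ℤ
import Data.Integer.Properties as ℤ
open import Data.List.Base using (List; []; _∷_; _++_; _∷ʳ_; [_]; length; reverse; map; take; drop; replicate; allFin; cartesianProductWith; initLast; _∷ʳ′_)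
open import Data.List.Membership.Propositional using (_∈_; _∉_; find; lose)
open import Data.List.Membership.Propositional.Properties using (∈-++⁺ˡ; ∈-++⁺ʳ; ∈-map⁺; ∈-map⁻; ∈-allFin; ∈-cartesianProductWith⁺; ∈-cartesianProductWith⁻)
open import Data.List.Membership.Propositional.Properties.WithK using (unique∧set⇒bag)
open import Data.List.Properties
open import Data.List.Relation.Binary.BagAndSetEquality using (∼bag⇒↭)
open import Data.List.Relation.Binary.Infix.Heterogeneous as Infix using (here; there; _++ⁱ_; _ⁱ++_)
open import Data.List.Relation.Binary.Infix.Heterogeneous.Properties using (infix?; length-mono)
import Data.List.Relation.Binary.Infix.Heterogeneous.Properties as Infix
open import Data.List.Relation.Binary.Permutation.Propositional.Properties using (↭-length)
open import Data.List.Relation.Binary.Pointwise using (Pointwise-≡⇒≡; ≡⇒Pointwise-≡)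
import Data.List.Relation.Binary.Prefix.Heterogeneous as Prefix
open import Data.List.Relation.Unary.All as All using (All; []; _∷_)
open import Data.List.Relation.Unary.AllPairs using ([]; _∷_)
open import Data.List.Relation.Unary.Any as Any using (here; there)
open import Data.List.Relation.Unary.Unique.Propositional using (Unique)
import Data.List.Relation.Unary.Unique.Propositional.Properties as Unique
open import Data.Nat.Base using (zero; suc; _+_; _*_; s≤s; z≤n)
open import Data.Nat.Properties hiding (_≟_)
import Data.Nat.Properties as ℕ
open import Data.Nat.Tactic.RingSolver using (solve-∀)
open import Data.Product.Base using (_,_; proj₁; proj₂)
open import Data.Rational.Base as ℚ using (0ℚ; toℚᵘ)
import Data.Rational.Properties as ℚ
import Data.Rational.Unnormalised.Base as ℚᵘ
import Data.Rational.Unnormalised.Properties as ℚᵘ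
open import Data.Sum.Base using (_⊎_; inj₁; inj₂; reduce)
open import Data.Unit.Base using (⊤; tt)
open import Function.Base using (_∘_; case_of_)
open import Function.Bundles using (mk⇔; Equivalence; Inverse)
open import Function.Definitions using (Injective)
open import Function.Properties.Inverse using (↔⇒↣)
open import Relation.Binary.Definitions using (DecidableEquality)
open import Relation.Binary.PropositionalEquality hiding ([_])
open import Relation.Nullary
open import Relation.Nullary.Decidable using (map′; via-injection; decidable-stable; from-yes; from-no)

-- A word is rich iff each of its letters completes a palindrome not seen
-- before.  Hence a letter y cannot extend a rich word w exactly when all
-- palindromic suffixes of wy already occur in w, and a stretch of forced
-- letters is produced by planting these palindromes early in w.
--
-- Long forced stretches come from the map σ that exchanges 0 and 1 and
-- separates consecutive letters by 0, for example σ(0110) = 1000001.  With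
-- S′ = 011001·σ(S), the palindromes of S′ are controlled by those of S: a new
-- palindrome p of S yields the new palindromes σ(p) and 0σ(p)0 of S′, so S′ is
-- rich when S is; the factors 11 and 1001 of the prefix rule out every
-- deviation from the separating zeros; and a letter forced after S forces its
-- image after S′.  So |S| = n with k forced letters becomes |S′| = 2n + 5 with
-- 2k + 1 forced letters, and k + 1 : n + 5 is preserved.  Starting from n = 47
-- and k = 11 this is 12 : 52 > 2 : 9.
--
-- For φ to be defined, every rich word w must have an extension that extends
-- in two ways.  If aⁿ is the longest power of a letter a in w, palindromic
-- closure leads to a rich extension ending in aⁿ, hence to one in which
-- aⁿ⁺¹ occurs for the first time; there a second letter is possible as well.

-- Rich words and new palindromes

infix 4 _≼_

_≼_ : {A : Set} → List A → List A → Set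
q ≼ w = ∃[ s ] w ≡ q ++ s

module _ {A : Set} where

  ++-split : ∀ (α γ : List A) {x y} → α ++ x ≡ γ ++ y →
    (∃[ δ ] (γ ≡ α ++ δ × x ≡ δ ++ y)) ⊎
    (∃[ c ] ∃[ δ ] (α ≡ γ ++ c ∷ δ × y ≡ c ∷ δ ++ x))
  ++-split []      γ       eq = inj₁ (γ , refl , eq)
  ++-split (a ∷ α) []      eq = inj₂ (a , α , refl , sym eq)
  ++-split (a ∷ α) (b ∷ γ) eq with refl , eq′ ← ∷-injective eq with ++-split α γ eq′
  ... | inj₁ (δ , p , q)     = inj₁ (δ , cong (a ∷_) p , q)
  ... | inj₂ (c , δ , p , q) = inj₂ (c , δ , cong (a ∷_) p , q)

  factor : ∀ α (q β : List A) → Factor q (α ++ q ++ β)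
  factor α q β = Infix.fromView (Infix.MkView α (≡⇒Pointwise-≡ refl) β)

  factor-split : ∀ {q w : List A} → Factor q w → ∃[ α ] ∃[ β ] w ≡ α ++ q ++ β
  factor-split f with Infix.MkView α p β ← Infix.toView f with refl ← Pointwise-≡⇒≡ p =
    α , β , refl

  factor-trans : ∀ {u v w : List A} → Factor u v → Factor v w → Factor u w
  factor-trans = Infix.trans trans

  factor-refl : ∀ {w : List A} → Factor w w
  factor-refl {w} = subst (Factor w) (++-identityʳ w) (factor [] w [])

  factor-reverse : ∀ {q w : List A} → Factor q w → Factor (reverse q) (reverse w)
  factor-reverse {q} f with α , β , refl ← factor-split f = subst (Factor (reverse q))
    (sym (trans (reverse-++ α (q ++ β))
         (trans (cong (_++ reverse α) (reverse-++ q β)) (++-assoc (reverse β) (reverse q) (reverse α)))))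
    (factor (reverse β) (reverse q) (reverse α))

  ≼⇒Factor : ∀ {q w : List A} → q ≼ w → Factor q w
  ≼⇒Factor {q} (s , refl) = factor [] q s

  ¬Factor-∷ : ∀ {x} {w : List A} → ¬ Factor (x ∷ w) w
  ¬Factor-∷ f = <-irrefl refl (length-mono f)

  palindrome-suffix : ∀ {v q s : List A} → Palindrome v → Palindrome q → v ≡ q ++ s → v ≡ reverse s ++ q
  palindrome-suffix {v} {q} {s} pv pq eq = begin
    v                      ≡⟨ pv ⟨
    reverse v              ≡⟨ cong reverse eq ⟩
    reverse (q ++ s)       ≡⟨ reverse-++ q s ⟩
    reverse s ++ reverse q ≡⟨ cong (reverse s ++_) pq ⟩
    reverse s ++ q         ∎
    where open ≡-Reasoning

  factor-tail : ∀ {x w} d {δ q s : List A} → x ∷ w ≡ (δ ∷ʳ d) ++ q ++ s → Factor q w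
  factor-tail d {[]}    {q} {s} refl = factor [] q s
  factor-tail d {_ ∷ δ} {q} {s} refl = factor (δ ∷ʳ d) q s

  -- As a palindromic prefix, `q` is also a suffix of the palindrome `v`, and that copy starts after
  -- the head.
  palindrome-prefix-tail : ∀ {x w v q c s} → Palindrome v → Palindrome q →
    v ≼ x ∷ w → v ≡ q ++ c ∷ s → Factor q w
  palindrome-prefix-tail {x} {w} {v} {q} {c} {s} pv pq (r , eq) eq′ =
    factor-tail c {reverse s} {q} {r} (begin
      x ∷ w                          ≡⟨ eq ⟩
      v ++ r                         ≡⟨ cong (_++ r) (palindrome-suffix pv pq eq′) ⟩
      (reverse (c ∷ s) ++ q) ++ r    ≡⟨ cong (λ z → (z ++ q) ++ r) (unfold-reverse c s) ⟩
      ((reverse s ∷ʳ c) ++ q) ++ r   ≡⟨ ++-assoc (reverse s ∷ʳ c) q r ⟩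
      (reverse s ∷ʳ c) ++ q ++ r     ∎)
    where open ≡-Reasoning

  -- The shorter of two new palindromes would recur at the end of the longer one, so a letter
  -- completes at most one.
  new-unique : ∀ {x w} {q v : List A} → Palindrome q → Palindrome v → q ≼ x ∷ w → v ≼ x ∷ w →
    ¬ Factor q w → ¬ Factor v w → q ≡ v
  new-unique {q = q} {v} pq pv q≼@(s , e) v≼@(r , e′) ¬q ¬v with ++-split q v (trans (sym e) e′)
  ... | inj₁ ([] , eq , _)    = sym (trans eq (++-identityʳ q))
  ... | inj₁ (c ∷ δ , eq , _) = ⊥-elim (¬q (palindrome-prefix-tail pv pq v≼ eq))
  ... | inj₂ (c , δ , eq , _) = ⊥-elim (¬v (palindrome-prefix-tail pq pv q≼ eq))

  take-length-++ : ∀ (q : List A) {s} → take (length q) (q ++ s) ≡ q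
  take-length-++ []      = refl
  take-length-++ (x ∷ q) = cong (x ∷_) (take-length-++ q)

  -- From here on words are read from right to left: the head of a list is
  -- the last letter, so that _∷_ extends a word.

  New : A → List A → Set
  New x w = ∃[ q ] (Palindrome q × q ≼ x ∷ w × ¬ Factor q w)

  StepRich : List A → Set
  StepRich []      = ⊤
  StepRich (x ∷ w) = New x w × StepRich w

  stepRich-++ : ∀ u {w} → StepRich (u ++ w) → StepRich w
  stepRich-++ []      r       = r
  stepRich-++ (_ ∷ u) (_ , r) = stepRich-++ u r

  -- A palindromic factor survives reversal unchanged, so one list enumerates both sets. This lets
  -- `Rich` be studied on words read from right to left.
  rich-reverse : ∀ {w : List A} → Rich w → Rich (reverse w)
  rich-reverse {w} (ps , unique , set , len) =
    ps , unique , (λ v → mk⇔ (to v) (from v)) , trans len (cong suc (sym (length-reverse w)))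
    where
    to : ∀ v → v ∈ ps → Palindrome v × Factor v (reverse w)
    to v v∈ with pv , fv ← Equivalence.to (set v) v∈ =
      pv , subst (λ u → Factor u (reverse w)) pv (factor-reverse fv)
    from : ∀ v → Palindrome v × Factor v (reverse w) → v ∈ ps
    from v (pv , fv) = Equivalence.from (set v)
      (pv , subst₂ Factor pv (reverse-involutive w) (factor-reverse fv))

-- Counting palindromes: equivalence of `Rich` and `StepRich`

module _ {A : Set} (_≟_ : DecidableEquality A) where

  palindrome? : ∀ (v : List A) → Dec (Palindrome v)
  palindrome? v = ≡-dec _≟_ (reverse v) v

  factor? : ∀ (v w : List A) → Dec (Factor v w)
  factor? = infix? _≟_

  new? : ∀ x w → Dec (New {A} x w)
  -- The bound of `anyUpTo?` is strict, so `2 + length w` covers every prefix of `x ∷ w`, the whole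
  -- word included.
  new? x w with anyUpTo? (λ k → palindrome? (take k (x ∷ w)) ×-dec ¬? (factor? (take k (x ∷ w)) w)) (2 + length w)
  ... | yes (k , _ , p , ¬f) = yes (take k (x ∷ w) , p , (drop k (x ∷ w) , sym (take++drop≡id k (x ∷ w))) , ¬f)
  ... | no ¬k = no λ (q , p , (s , eq) , ¬f) →
    let take≡q = trans (cong (take (length q)) eq) (take-length-++ q)
    in ¬k (length q
          , s≤s (≤-trans (m≤m+n (length q) (length s)) (≤-reflexive (trans (sym (length-++ q)) (cong length (sym eq)))))
          , subst Palindrome (sym take≡q) p , subst (λ v → ¬ Factor v w) (sym take≡q) ¬f)

  stepRich? : ∀ w → Dec (StepRich {A} w)
  stepRich? []      = yes tt
  stepRich? (x ∷ w) = new? x w ×-dec stepRich? w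

  palindromes : List A → List (List A)
  palindromes []      = [] ∷ []
  palindromes (x ∷ w) with new? x w
  ... | yes (q , _) = q ∷ palindromes w
  ... | no _        = palindromes w

  ∈-palindromes⁻ : ∀ w {v} → v ∈ palindromes w → Palindrome v × Factor v w
  ∈-palindromes⁻ []      (here refl) = refl , factor-refl
  ∈-palindromes⁻ (x ∷ w) v∈ with new? x w
  ∈-palindromes⁻ (x ∷ w) (here refl) | yes (q , p , q≼ , _) = p , ≼⇒Factor q≼
  ∈-palindromes⁻ (x ∷ w) (there v∈)  | yes _ with p , f ← ∈-palindromes⁻ w v∈ = p , there f
  ∈-palindromes⁻ (x ∷ w) v∈          | no _  with p , f ← ∈-palindromes⁻ w v∈ = p , there f

  -- A palindrome of `x ∷ w` absent from `w` must be a prefix; it is then new, and `new-unique`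
  -- identifies it with the recorded one.
  ∈-palindromes⁺ : ∀ w {v} → Palindrome v → Factor v w → v ∈ palindromes w
  ∈-palindromes⁺ []      {[]}    p f = here refl
  ∈-palindromes⁺ []      {_ ∷ _} p f with () ← length-mono f
  ∈-palindromes⁺ (x ∷ w) {v} p f with new? x w | factor? v w
  ... | yes _ | yes f′ = there (∈-palindromes⁺ w p f′)
  ... | no  _ | yes f′ = ∈-palindromes⁺ w p f′
  ... | n     | no ¬f with factor-split f
  ...   | _ ∷ α , β , eq = ⊥-elim (¬f (subst (Factor v) (sym (∷-injectiveʳ eq)) (factor α v β)))
  ...   | []    , β , eq with n
  ...     | yes (q , pq , q≼ , ¬q) = here (new-unique p pq (β , eq) q≼ ¬f ¬q)
  ...     | no ¬n = ⊥-elim (¬n (v , p , (β , eq) , ¬f))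

  palindromes-unique : ∀ w → Unique (palindromes w)
  palindromes-unique []      = [] ∷ []
  palindromes-unique (x ∷ w) with new? x w
  ... | yes (q , _ , _ , ¬q) =
    All.tabulate (λ v∈ q≡v → ¬q (subst (λ u → Factor u w) (sym q≡v) (proj₂ (∈-palindromes⁻ w v∈))))
    ∷ palindromes-unique w
  ... | no _ = palindromes-unique w

  length-palindromes : ∀ w → length (palindromes w) ≤ suc (length w)
  length-palindromes []      = ≤-refl
  length-palindromes (x ∷ w) with new? x w
  ... | yes _ = s≤s (length-palindromes w)
  ... | no _  = m≤n⇒m≤1+n (length-palindromes w)

  -- Each letter contributes at most one palindrome, so attaining the bound of `length-palindromes`
  -- makes every letter contribute.
  length⇒stepRich : ∀ w → length (palindromes w) ≡ suc (length w) → StepRich w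
  length⇒stepRich []      _   = tt
  length⇒stepRich (x ∷ w) len with new? x w
  ... | yes n = n , length⇒stepRich w (suc-injective len)
  ... | no _  = ⊥-elim (<-irrefl len (s≤s (length-palindromes w)))

  stepRich⇒length : ∀ w → StepRich w → length (palindromes w) ≡ suc (length w)
  stepRich⇒length []      _       = refl
  stepRich⇒length (x ∷ w) (n , r) with new? x w
  ... | yes _ = cong suc (stepRich⇒length w r)
  ... | no ¬n = ⊥-elim (¬n n)

  stepRich⇒rich : ∀ {w} → StepRich w → Rich w
  stepRich⇒rich {w} r = palindromes w , palindromes-unique w
    , (λ v → mk⇔ (∈-palindromes⁻ w) (λ (p , f) → ∈-palindromes⁺ w p f)) , stepRich⇒length w r

  rich⇒stepRich : ∀ {w} → Rich w → StepRich w
  rich⇒stepRich {w} (ps , unique , set , len) = length⇒stepRich w (trans (↭-length perm) len)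
    where
    -- Duplicate-free lists with the same members are permutations of each other, so the length of
    -- `ps` carries over.
    perm = ∼bag⇒↭ (unique∧set⇒bag (palindromes-unique w) unique λ {v} → mk⇔
      (λ v∈ → Equivalence.from (set v) (∈-palindromes⁻ w v∈))
      (λ v∈ → let p , f = Equivalence.to (set v) v∈ in ∈-palindromes⁺ w p f))

  -- `StepRich` scans in one direction; the symmetry comes from the counting definition.
  stepRich-reverse : ∀ {w} → StepRich w → StepRich (reverse w)
  stepRich-reverse = rich⇒stepRich ∘ rich-reverse ∘ stepRich⇒rich

  rich⇒stepRich-reverse : ∀ {w} → Rich w → StepRich (reverse w)
  rich⇒stepRich-reverse = rich⇒stepRich ∘ rich-reverse

  stepRich-reverse⇒rich : ∀ {w} → StepRich (reverse w) → Rich w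
  stepRich-reverse⇒rich {w} = subst Rich (reverse-involutive w) ∘ rich-reverse ∘ stepRich⇒rich

-- Existence of extendable extensions

module _ {A : Set} where

  palindrome-wrap : ∀ c {p : List A} → Palindrome p → Palindrome (c ∷ p ∷ʳ c)
  palindrome-wrap c {p} pp = trans (unfold-reverse c (p ∷ʳ c))
    (cong (_∷ʳ c) (trans (reverse-++ p [ c ]) (cong (c ∷_) pp)))

  palindrome-wrap⁻ : ∀ {c d} {p : List A} → Palindrome (c ∷ p ∷ʳ d) → Palindrome p
  palindrome-wrap⁻ {c} {d} {p} pal = ∷ʳ-injectiveˡ (reverse p) p
    (∷-injectiveʳ (trans (sym (trans (unfold-reverse c (p ∷ʳ d)) (cong (_∷ʳ c) (reverse-++ p [ d ])))) pal))

  palindrome-ends : ∀ {c d} {p : List A} → Palindrome (c ∷ p ∷ʳ d) → c ≡ d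
  palindrome-ends {c} {d} {p} pal =
    sym (∷-injectiveˡ (trans (sym (trans (unfold-reverse c (p ∷ʳ d)) (cong (_∷ʳ c) (reverse-++ p [ d ])))) pal))

  prefix-unique : ∀ {w q q′ s s′ : List A} → w ≡ q ++ s → w ≡ q′ ++ s′ → length q ≡ length q′ → q ≡ q′
  prefix-unique {w} {q} {q′} e e′ len = begin
    q                   ≡⟨ take-length-++ q ⟨
    take (length q) (q ++ _)  ≡⟨ cong₂ take len (trans (sym e) e′) ⟩
    take (length q′) (q′ ++ _) ≡⟨ take-length-++ q′ ⟩
    q′                  ∎
    where open ≡-Reasoning

  prefix-compare : ∀ {w q q′ s s′ : List A} → w ≡ q ++ s → w ≡ q′ ++ s′ → length q ≤ length q′ → q ≼ q′
  prefix-compare {q = q} {q′} e e′ len with ++-split q q′ (trans (sym e) e′)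
  ... | inj₁ (δ , eq , _)     = δ , eq
  ... | inj₂ (c , δ , eq , _) = ⊥-elim (<⇒≱ (subst (length q′ <_) (trans (sym (length-++ q′)) (cong length (sym eq)))
                                    (m<m+n (length q′) (s≤s z≤n))) len)

  split-at : ∀ k (w : List A) → k < length w → ∃[ q ] ∃[ c ] ∃[ s ] (w ≡ q ++ c ∷ s × length q ≡ k)
  split-at zero    (x ∷ w) _        = [] , x , w , refl , refl
  split-at (suc k) (x ∷ w) (s≤s lt) with q , c , s , eq , len ← split-at k w lt =
    x ∷ q , c , s , cong (x ∷_) eq , cong suc len

  OnlyAtHead : List A → List A → Set
  OnlyAtHead p w = ∀ {x t} → w ≡ x ∷ t → ¬ Factor p t

  -- Any occurrence of `c ∷ p ∷ʳ c` contains an occurrence of `p` past the head.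
  onlyAtHead-wrap : ∀ {p w} c → OnlyAtHead p w → ¬ Factor (c ∷ p ∷ʳ c) w
  onlyAtHead-wrap {p} {w} c only f with factor-split f
  onlyAtHead-wrap {p} {[]}    c only f | [] , _ , ()
  onlyAtHead-wrap {p} {[]}    c only f | _ ∷ _ , _ , ()
  onlyAtHead-wrap {p} {x ∷ w} c only f | α , β , eq = only refl (factor-tail c {α} {p} {c ∷ β} (begin
    x ∷ w                       ≡⟨ eq ⟩
    α ++ c ∷ (p ∷ʳ c) ++ β      ≡⟨ cong (λ u → α ++ c ∷ u) (++-assoc p [ c ] β) ⟩
    α ++ c ∷ p ++ c ∷ β         ≡⟨ ++-assoc α [ c ] (p ++ c ∷ β) ⟨
    (α ∷ʳ c) ++ p ++ c ∷ β      ∎))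
    where open ≡-Reasoning

  -- The letter `c` that follows `p` is repeated in front: `c ∷ p ∷ʳ c` is new and again occurs only
  -- at the head, so the step iterates until `z` is mirrored.
  palindromic-extension : ∀ p z {z′} → Palindrome p → StepRich (p ++ z ++ z′) → OnlyAtHead p (p ++ z ++ z′) →
    StepRich (reverse z ++ p ++ z ++ z′)
  palindromic-extension p []      pp r _    = r
  palindromic-extension p (c ∷ z) {z′} pp r only = subst StepRich shift
    (palindromic-extension (c ∷ p ∷ʳ c) z (palindrome-wrap c pp)
      (subst StepRich regroup (new , r)) (λ eq → subst (λ w → ¬ Factor _ w) (∷-injectiveʳ (trans regroup eq)) fresh))
    where
    v = p ++ c ∷ z ++ z′
    fresh : ¬ Factor (c ∷ p ∷ʳ c) v
    fresh = onlyAtHead-wrap c only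
    regroup : c ∷ v ≡ (c ∷ p ∷ʳ c) ++ z ++ z′
    regroup = cong (c ∷_) (sym (++-assoc p [ c ] (z ++ z′)))
    new : New c v
    new = c ∷ p ∷ʳ c , palindrome-wrap c pp , (z ++ z′ , regroup) , fresh
    shift : reverse z ++ (c ∷ p ∷ʳ c) ++ z ++ z′ ≡ reverse (c ∷ z) ++ v
    shift = trans (cong (reverse z ++_) (sym regroup))
      (trans (sym (++-assoc (reverse z) [ c ] v)) (cong (_++ v) (sym (unfold-reverse c z))))

  palindrome-mirror : ∀ {p : List A} z → Palindrome p → Palindrome (reverse z ++ p ++ z)
  palindrome-mirror {p} z pp = begin
    reverse (reverse z ++ p ++ z)                 ≡⟨ reverse-++ (reverse z) (p ++ z) ⟩
    reverse (p ++ z) ++ reverse (reverse z)       ≡⟨ cong₂ _++_ (reverse-++ p z) (reverse-involutive z) ⟩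
    (reverse z ++ reverse p) ++ z                 ≡⟨ cong (λ q → (reverse z ++ q) ++ z) pp ⟩
    (reverse z ++ p) ++ z                         ≡⟨ ++-assoc (reverse z) p z ⟩
    reverse z ++ p ++ z                           ∎
    where open ≡-Reasoning

  -- The palindrome completed by the newest letter occurs only at the head, so all that follows it
  -- can be mirrored in front.
  palindromic-closure : ∀ x t → StepRich (x ∷ t) →
    ∃[ u ] (StepRich (u ++ x ∷ t) × Palindrome (u ++ x ∷ t))
  palindromic-closure x t r@((q , pq , (z , eq) , ¬q) , _) =
    reverse z
    , subst (λ w → StepRich (reverse z ++ w)) same
        (palindromic-extension q z {[]} pq (subst StepRich (sym same) r)
          (λ eq′ → subst (λ w → ¬ Factor q w) (∷-injectiveʳ (trans (sym same) eq′)) ¬q))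
    , subst (λ w → Palindrome (reverse z ++ w)) (sym eq) (palindrome-mirror z pq)
    where
    same : q ++ z ++ [] ≡ x ∷ t
    same = trans (cong (q ++_) (++-identityʳ z)) (sym eq)

  Extendable : List A → Set
  Extendable w = ∃[ x ] ∃[ y ] (x ≢ y × StepRich (x ∷ w) × StepRich (y ∷ w))

module _ {A : Set} (_≟_ : DecidableEquality A) where

  -- Lengths are tried downwards from `k`. With `k` one below `length w` this yields the longest
  -- proper palindromic prefix.
  longest-palindromic-prefix : ∀ k (w : List A) → k < length w → ∃[ p ] ∃[ c ] ∃[ z ]
    (w ≡ p ++ c ∷ z × Palindrome p
     × (∀ {q s} → w ≡ q ++ s → Palindrome q → length q ≤ k → length q ≤ length p))
  longest-palindromic-prefix zero    (x ∷ w) _  = [] , x , w , refl , refl , λ _ _ le → le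
  longest-palindromic-prefix (suc k) w       lt
    with p , c , z , eq , len ← split-at (suc k) w lt | palindrome? _≟_ p
  ... | yes pp = p , c , z , eq , pp , λ _ _ le → ≤-trans le (≤-reflexive (sym len))
  ... | no ¬pp with p′ , c′ , z′ , eq′ , pp′ , longest ← longest-palindromic-prefix k w (<-trans (n<1+n k) lt) =
    p′ , c′ , z′ , eq′ , pp′ , λ {q} e pq le → longest e pq
      (≤-pred (≤∧≢⇒< le λ len′ → ¬pp (subst Palindrome (prefix-unique e eq (trans len′ (sym len))) pq)))

  -- A second occurrence of p inside P would end a palindromic return to p,
  -- which by maximality of p has nowhere to go.
  wrap-longest-new : ∀ {P p c z} → StepRich {A} P → Palindrome P → P ≡ p ++ c ∷ z → Palindrome p →
    (∀ {q c s} → P ≡ q ++ c ∷ s → Palindrome q → length q ≤ length p) → ¬ Factor (c ∷ p ∷ʳ c) P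
  wrap-longest-new {P} {p} {c} {z} r pP eq pp longest f
    with γ , δ , occ ← factor-split f = go (reverse t) refl (stepRich-reverse _≟_ (stepRich-++ (γ ∷ʳ c) (subst StepRich occ′ r)))
    where
    open ≡-Reasoning
    t = p ++ c ∷ δ
    occ′ : P ≡ (γ ∷ʳ c) ++ t
    occ′ = begin
      P                        ≡⟨ occ ⟩
      γ ++ c ∷ (p ∷ʳ c) ++ δ   ≡⟨ cong (λ u → γ ++ c ∷ u) (++-assoc p [ c ] δ) ⟩
      γ ++ c ∷ t               ≡⟨ ++-assoc γ [ c ] t ⟨
      (γ ∷ʳ c) ++ t            ∎
    rev-t : reverse t ≡ (reverse δ ∷ʳ c) ++ p
    rev-t = trans (reverse-++ p (c ∷ δ)) (cong₂ _++_ (unfold-reverse c δ) pp)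
    P-rev : P ≡ reverse t ++ c ∷ reverse γ
    P-rev = begin
      P                                ≡⟨ pP ⟨
      reverse P                        ≡⟨ cong reverse occ′ ⟩
      reverse ((γ ∷ʳ c) ++ t)          ≡⟨ reverse-++ (γ ∷ʳ c) t ⟩
      reverse t ++ reverse (γ ∷ʳ c)    ≡⟨ cong (reverse t ++_) (reverse-++ γ [ c ]) ⟩
      reverse t ++ c ∷ reverse γ       ∎
    go : ∀ w → reverse t ≡ w → StepRich w → _
    as-cons : ∀ (s : List A) → ∃[ d ] ∃[ s′ ] s ++ c ∷ reverse γ ≡ d ∷ s′
    as-cons []      = c , reverse γ , refl
    as-cons (d ∷ s) = d , s ++ c ∷ reverse γ , refl
    go [] e _ with () ← ++-conicalʳ p (c ∷ δ) (reverse-injective {x = t} {y = []} e)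
    -- The new palindrome `q` of `reverse t` is a proper palindromic prefix of `P`, hence a prefix
    -- of `p`. Since `p` also ends `reverse t`, `q` recurs in `w`.
    go (x ∷ w) e ((q , pq , (s , qs) , ¬q) , _) = ¬q (factor-tail c {reverse δ} {q} {s₂} (begin
      x ∷ w                          ≡⟨ e ⟨
      reverse t                      ≡⟨ rev-t ⟩
      (reverse δ ∷ʳ c) ++ p          ≡⟨ cong ((reverse δ ∷ʳ c) ++_) (proj₂ q≼p) ⟩
      (reverse δ ∷ʳ c) ++ q ++ s₂    ∎))
      where
      tail = as-cons s
      P≡q : P ≡ q ++ proj₁ tail ∷ proj₁ (proj₂ tail)
      P≡q = begin
        P                               ≡⟨ P-rev ⟩
        reverse t ++ c ∷ reverse γ      ≡⟨ cong (_++ c ∷ reverse γ) (trans e qs) ⟩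
        (q ++ s) ++ c ∷ reverse γ       ≡⟨ ++-assoc q s (c ∷ reverse γ) ⟩
        q ++ s ++ c ∷ reverse γ         ≡⟨ cong (q ++_) (proj₂ (proj₂ tail)) ⟩
        q ++ _                          ∎
      q≼p : q ≼ p
      q≼p = prefix-compare P≡q eq (longest P≡q pq)
      s₂ = proj₁ q≼p

  -- The border `p` gives `P` the period `length (c ∷ z)`, and the extension continues this period
  -- for one turn. Its first letter is allowed by `wrap-longest-new`, the others by
  -- `palindromic-extension`.
  periodic-extension : ∀ {P} → P ≢ [] → StepRich {A} P → Palindrome P →
    ∃[ p ] ∃[ c ] ∃[ z ] (P ≡ p ++ c ∷ z × Palindrome p × StepRich (reverse z ++ c ∷ P))
  periodic-extension {[]}     ne _ _  = ⊥-elim (ne refl)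
  periodic-extension {x ∷ t} _  r pP
    with p , c , z , eq , pp , longest ← longest-palindromic-prefix (length t) (x ∷ t) ≤-refl =
    p , c , z , eq , pp , subst (λ w → StepRich (reverse z ++ w)) same
      (palindromic-extension (c ∷ p ∷ʳ c) z {[]} (palindrome-wrap c pp)
        (subst StepRich (sym same) ((c ∷ p ∷ʳ c , palindrome-wrap c pp , (z ++ [] , sym same) , new) , r))
        (λ eq′ → subst (λ w → ¬ Factor _ w) (∷-injectiveʳ (trans (sym same) eq′)) new))
    where
    new : ¬ Factor (c ∷ p ∷ʳ c) (x ∷ t)
    new = wrap-longest-new r pP eq pp λ {q} {d} {s} e pq → longest e pq (≤-pred (≤-trans
      (m<m+n (length q) {suc (length s)} (s≤s z≤n))
      (≤-reflexive (trans (sym (length-++ q)) (cong length (sym e))))))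
    same : (c ∷ p ∷ʳ c) ++ z ++ [] ≡ c ∷ x ∷ t
    same = cong (c ∷_) (trans (++-assoc p [ c ] (z ++ []))
      (trans (cong (λ u → p ++ c ∷ u) (++-identityʳ z)) (sym eq)))

  -- Moves a factor `f` of a rich palindrome to the head of a rich extension, by induction on a
  -- bound `n` for its distance `length α` from the head.
  recur : ∀ {P} → StepRich {A} P → Palindrome P → ∀ n α {f β} → length α ≤ n → P ≡ α ++ f ++ β →
    ∃[ u ] (StepRich (u ++ P) × f ≼ u ++ P)
  recur r pP _       []      {f} {β} _  eq = [] , r , (β , eq)
  recur {P} r pP (suc n) α@(a ∷ _) {f} {β} le eq
    with p , c , z , P≡ , pp , ext ← periodic-extension {P} (λ { refl → case eq of λ () }) r pP
    with P≡′ ← trans (palindrome-suffix pP pp P≡) (cong (_++ p) (unfold-reverse c z))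
    with ++-split α (reverse z ∷ʳ c) (trans (sym eq) P≡′)
  -- Here `f` starts within the first period or right after it, so the added turn creates a copy;
  -- the letters `α` in front of that copy are dropped.
  ... | inj₁ (α′ , zc≡ , _) = α′ , stepRich-++ α (subst StepRich split ext) , (β ++ c ∷ z , ++-cancelˡ α _ _ eq′)
    where
    open ≡-Reasoning
    split : reverse z ++ c ∷ P ≡ α ++ α′ ++ P
    split = trans (sym (++-assoc (reverse z) [ c ] P)) (trans (cong (_++ P) zc≡) (++-assoc α α′ P))
    eq′ : α ++ α′ ++ P ≡ α ++ f ++ β ++ c ∷ z
    eq′ = begin
      α ++ α′ ++ P                          ≡⟨ split ⟨
      reverse z ++ c ∷ P                    ≡⟨ cong (λ w → reverse z ++ c ∷ w) P≡ ⟩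
      reverse z ++ c ∷ p ++ c ∷ z           ≡⟨ ++-assoc (reverse z) (c ∷ p) (c ∷ z) ⟨
      (reverse z ++ c ∷ p) ++ c ∷ z         ≡⟨ cong (_++ c ∷ z) (++-assoc (reverse z) [ c ] p) ⟨
      ((reverse z ∷ʳ c) ++ p) ++ c ∷ z      ≡⟨ cong (_++ c ∷ z) P≡′ ⟨
      P ++ c ∷ z                            ≡⟨ cong (_++ c ∷ z) eq ⟩
      (α ++ f ++ β) ++ c ∷ z                ≡⟨ ++-assoc α (f ++ β) (c ∷ z) ⟩
      α ++ (f ++ β) ++ c ∷ z                ≡⟨ cong (α ++_) (++-assoc f β (c ∷ z)) ⟩
      α ++ f ++ β ++ c ∷ z                  ∎
  -- Here `f` lies inside the border `p`, which is also a prefix of `P`, so `f` has an occurrence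
  -- nearer to the head.
  ... | inj₂ (d , α′ , α≡ , p≡) = recur r pP n (d ∷ α′) shorter (begin
      P                              ≡⟨ P≡ ⟩
      p ++ c ∷ z                     ≡⟨ cong (_++ c ∷ z) p≡ ⟩
      (d ∷ α′ ++ f ++ β) ++ c ∷ z    ≡⟨ ++-assoc (d ∷ α′) (f ++ β) (c ∷ z) ⟩
      d ∷ α′ ++ (f ++ β) ++ c ∷ z    ≡⟨ cong ((d ∷ α′) ++_) (++-assoc f β (c ∷ z)) ⟩
      d ∷ α′ ++ f ++ β ++ c ∷ z      ∎)
    where
    open ≡-Reasoning
    shorter : length (d ∷ α′) ≤ n
    shorter = ≤-pred (≤-trans (≤-trans (+-monoˡ-≤ (length (d ∷ α′)) {1} (≤-trans (s≤s z≤n) (≤-reflexive (sym (length-++-∷ʳ (reverse z))))))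
      (≤-reflexive (trans (sym (length-++ (reverse z ∷ʳ c))) (cong length (sym α≡))))) le)
      where
      length-++-∷ʳ : ∀ (w : List A) → length (w ∷ʳ c) ≡ suc (length w)
      length-++-∷ʳ w = trans (length-++ w) (+-comm (length w) 1)

  power-palindrome : ∀ (a : A) n → Palindrome (replicate n a)
  power-palindrome a zero    = refl
  power-palindrome a (suc n) = trans (unfold-reverse a (replicate n a))
    (trans (cong (_∷ʳ a) (power-palindrome a n)) (snoc n))
    where
    snoc : ∀ n → replicate n a ∷ʳ a ≡ a ∷ replicate n a
    snoc zero    = refl
    snoc (suc n) = cong (a ∷_) (snoc n)

  -- A further `a` completes a longer power. The second letter is the `d` following the power in the
  -- list, which differs from `a` since the power is fresh; if nothing follows, `b` itself is a new
  -- palindrome.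
  fresh-power-extendable : ∀ {a b x} n {t} → a ≢ b → StepRich (x ∷ t) →
    replicate (suc n) a ≼ x ∷ t → ¬ Factor (replicate (suc n) a) t → Extendable (x ∷ t)
  fresh-power-extendable {a} {b} {x} n {t} a≢b r (s , eq) ¬f = cases s eq
    where
    power = replicate (suc n) a
    new-a : New a (x ∷ t)
    new-a = a ∷ power , power-palindrome a (2 + n) , (s , cong (a ∷_) eq) , λ f → case factor-split f of λ where
      (α , β , e) → ¬f (factor-tail a {α} {power} {β} (trans e (sym (++-assoc α [ a ] _))))
    not-in : ∀ n → ¬ Factor [ b ] (replicate n a)
    not-in zero    (here ())
    not-in (suc n) (here (b≡a Prefix.∷ _)) = a≢b (sym b≡a)
    not-in (suc n) (there f) = not-in n f
    power-∷ : ∀ n {s} → replicate n a ++ a ∷ s ≡ a ∷ replicate n a ++ s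
    power-∷ zero    = refl
    power-∷ (suc n) = cong (a ∷_) (power-∷ n)
    cases : ∀ s → x ∷ t ≡ power ++ s → Extendable (x ∷ t)
    cases []      eq = a , b , a≢b , (new-a , r) , (([ b ] , refl , (x ∷ t , refl) , λ f →
      not-in (suc n) (subst (Factor [ b ]) (trans eq (++-identityʳ power)) f)) , r)
    cases (d ∷ s) eq with d ≟ a
    ... | yes refl = ⊥-elim (¬f (subst (Factor power) (sym (∷-injectiveʳ (trans eq (power-∷ (suc n))))) (factor [] power s)))
    ... | no d≢a = a , d , d≢a ∘ sym , (new-a , r)
      , ((d ∷ power ∷ʳ d , palindrome-wrap d (power-palindrome a (suc n))
         , (s , cong (d ∷_) (trans eq (sym (++-assoc power [ d ] s))))
         , onlyAtHead-wrap d (λ { refl → ¬f })) , r)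

  first-power : ∀ {a b} n u {w} → a ≢ b → StepRich (u ++ w) → Factor (replicate (suc n) a) (u ++ w) →
    ¬ Factor (replicate (suc n) a) w → ∃[ u′ ] (StepRich (u′ ++ w) × Extendable (u′ ++ w))
  first-power n []      a≢b r f ¬f = ⊥-elim (¬f f)
  first-power {a} n (x ∷ u) {w} a≢b r f ¬f with factor? _≟_ (replicate (suc n) a) (u ++ w)
  ... | yes f′ = first-power n u a≢b (proj₂ r) f′ ¬f
  ... | no ¬f′ with factor-split f
  ...   | []    , β , eq = x ∷ u , r , fresh-power-extendable n a≢b r (β , eq) ¬f′
  ...   | _ ∷ α , β , eq = ⊥-elim (¬f′ (subst (Factor _) (sym (∷-injectiveʳ eq)) (factor α _ β)))

  longest-power : ∀ (a : A) w → ∃[ n ] (Factor (replicate n a) w × ¬ Factor (replicate (suc n) a) w)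
  longest-power a w = search (suc (length w)) (λ f →
    <-irrefl refl (≤-trans (≤-reflexive (sym (length-replicate (suc (length w))))) (length-mono f)))
    where
    search : ∀ n → ¬ Factor (replicate n a) w → ∃[ n ] (Factor (replicate n a) w × ¬ Factor (replicate (suc n) a) w)
    search zero    ¬f = ⊥-elim (¬f (factor [] [] w))
    search (suc n) ¬f with factor? _≟_ (replicate n a) w
    ... | yes f = n , f , ¬f
    ... | no ¬f′ = search n ¬f′

  -- Bring a longest power a^n of w to the front and extend it by a: when the
  -- power a^(n+1) occurs for the first time, both a further a and the letter
  -- preceding the power create a new palindrome.
  extendable-extension : ∀ {a b : A} → a ≢ b → ∀ w → StepRich w → ∃[ u ] (StepRich (u ++ w) × Extendable (u ++ w))
  extendable-extension {a} {b} a≢b [] _ = [] , tt , a , b , a≢b , (new , tt) , (new , tt)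
    where
    new : ∀ {x} → New x []
    new {x} = [ x ] , refl , ([] , refl) , ¬Factor-∷
  extendable-extension {a} {b} a≢b w@(x ∷ t) r
    with u , rP , pP ← palindromic-closure x t r
    with n , f , ¬f ← longest-power a w
    with α , β , eq ← factor-split (u ++ⁱ f)
    with v , rv , (s , eq′) ← recur rP pP (length α) α ≤-refl eq
    with assoc ← ++-assoc v u w
    -- The longer power may have appeared during the extension already; otherwise one more `a` in
    -- front creates it.
    with factor? _≟_ (replicate (suc n) a) ((v ++ u) ++ w)
  ... | yes f′ = first-power n (v ++ u) a≢b (subst StepRich (sym assoc) rv) f′ ¬f
  ... | no ¬f′ = first-power n (a ∷ v ++ u) a≢b
    ((replicate (suc n) a , power-palindrome a (suc n) , (s , a∷≡) , ¬f′) , subst StepRich (sym assoc) rv)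
    (≼⇒Factor (s , a∷≡)) ¬f
    where
    a∷≡ = cong (a ∷_) (trans assoc eq′)

-- The functions ω and φ over a finite alphabet

least : ∀ {S : ℕ → Set} → (∀ k → Dec (S k)) → ∀ {n} → S n → ∃[ m ] IsMin S m
least {S} S? {n} Sn with search (suc n)
  where
  search : ∀ n → (∃[ m ] IsMin S m) ⊎ (∀ k → k < n → ¬ S k)
  search zero    = inj₂ λ _ ()
  search (suc n) with search n
  ... | inj₁ found = inj₁ found
  ... | inj₂ none with S? n
  ...   | yes Sn = inj₁ (n , Sn , λ k Sk → ≮⇒≥ λ k<n → none k k<n Sk)
  ...   | no ¬Sn = inj₂ λ k k<1+n Sk → case m≤n⇒m<n∨m≡n (≤-pred k<1+n) of λ where
    (inj₁ k<n)  → none k k<n Sk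
    (inj₂ refl) → ¬Sn Sk
... | inj₁ found = found
... | inj₂ none  = ⊥-elim (none n ≤-refl Sn)

isMin-unique : ∀ {S m n} → IsMin S m → IsMin S n → m ≡ n
isMin-unique (Sm , minm) (Sn , minn) = ≤-antisym (minm _ Sn) (minn _ Sm)

module _ {A : Set} (_≟_ : DecidableEquality A) where

  K⇒extendable : ∀ {w u} → K {A} w u → Extendable (reverse (w ++ u))
  K⇒extendable {w} {u} (_ , x , y , x≢y , rx , ry) = x , y , x≢y , step rx , step ry
    where
    step : ∀ {z} → Rich ((w ++ u) ∷ʳ z) → StepRich (z ∷ reverse (w ++ u))
    step {z} r = subst StepRich (reverse-++ (w ++ u) [ z ]) (rich⇒stepRich-reverse _≟_ r)

  extendable⇒K : ∀ {w u} → StepRich {A} (reverse (w ++ u)) → Extendable (reverse (w ++ u)) → K w u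
  extendable⇒K {w} {u} r (x , y , x≢y , rx , ry) =
    stepRich-reverse⇒rich _≟_ r , x , y , x≢y , step rx , step ry
    where
    step : ∀ {z} → StepRich (z ∷ reverse (w ++ u)) → Rich ((w ++ u) ∷ʳ z)
    step {z} r = stepRich-reverse⇒rich _≟_ (subst StepRich (sym (reverse-++ (w ++ u) [ z ])) r)

module Finite {A : Set} {a : ℕ} (A↔Fin : A ↔ Fin a) where

  open Inverse A↔Fin

  _≟_ : DecidableEquality A
  _≟_ = via-injection (↔⇒↣ A↔Fin) Fin._≟_

  letters : List A
  letters = map from (allFin a)

  ∈-letters : ∀ x → x ∈ letters
  ∈-letters x = subst (_∈ letters) (strictlyInverseʳ x) (∈-map⁺ from (∈-allFin (to x)))

  words : ℕ → List (List A)
  words zero    = [] ∷ []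
  words (suc n) = cartesianProductWith _∷_ letters (words n)

  ∈-words : ∀ w → w ∈ words (length w)
  ∈-words []      = here refl
  ∈-words (x ∷ w) = ∈-cartesianProductWith⁺ _∷_ (∈-letters x) (∈-words w)

  length-words : ∀ n {w} → w ∈ words n → length w ≡ n
  length-words zero    (here refl) = refl
  length-words (suc n) w∈ with _ , u , _ , u∈ , refl ← ∈-cartesianProductWith⁻ _∷_ letters (words n) w∈ =
    cong suc (length-words n u∈)

  ∃letter? : ∀ {P : A → Set} → (∀ x → Dec (P x)) → Dec (∃[ x ] P x)
  ∃letter? P? = map′ (λ any → let x , _ , Px = find any in x , Px)
    (λ (x , Px) → lose (∈-letters x) Px) (Any.any? P? letters)

  ∃word? : ∀ {P : List A → Set} → (∀ u → Dec (P u)) → ∀ k → Dec (∃[ u ] (P u × length u ≡ k))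
  ∃word? P? k = map′ (λ any → let u , _ , Pu = find any in u , Pu)
    (λ { (u , Pu , refl) → lose (∈-words u) (Pu , refl) })
    (Any.any? (λ u → P? u ×-dec (length u ℕ.≟ k)) (words k))

  extendable? : ∀ (w : List A) → Dec (Extendable w)
  extendable? w = ∃letter? λ x → ∃letter? λ y →
    ¬? (x ≟ y) ×-dec stepRich? _≟_ (x ∷ w) ×-dec stepRich? _≟_ (y ∷ w)

  rich? : ∀ (w : List A) → Dec (Rich w)
  rich? w = map′ (stepRich⇒rich _≟_) (rich⇒stepRich _≟_) (stepRich? _≟_ w)

  K? : ∀ (w u : List A) → Dec (K w u)
  K? w u = map′ (λ (r , e) → extendable⇒K _≟_ {w} {u} r e)
    (λ k@(r , _) → rich⇒stepRich-reverse _≟_ r , K⇒extendable _≟_ {w} {u} k)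
    (stepRich? _≟_ (reverse (w ++ u)) ×-dec extendable? (reverse (w ++ u)))

  K-nonempty⇒ω : ∀ {w : List A} → ∃[ u ] K w u → ∃[ k ] ω w k
  K-nonempty⇒ω {w} (u , k) = least (∃word? (K? w)) (u , k , refl)

  module _ {x y : A} (x≢y : x ≢ y) where

    K-nonempty : ∀ (w : List A) → Rich w → ∃[ u ] K w u
    K-nonempty w r = toK (extendable-extension _≟_ x≢y (reverse w) (rich⇒stepRich-reverse _≟_ r))
      where
      toK : ∃[ u ] (StepRich (u ++ reverse w) × Extendable (u ++ reverse w)) → ∃[ u ] K w u
      toK (u , ru , e) = reverse u , extendable⇒K _≟_ {w} {reverse u} (subst StepRich eq ru) (subst Extendable eq e)
        where
        eq : u ++ reverse w ≡ reverse (w ++ reverse u)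
        eq = sym (trans (reverse-++ w (reverse u)) (cong (_++ reverse w) (reverse-involutive u)))

    ω-defined : ∀ (w : List A) → Rich w → ∃[ k ] ω w k
    ω-defined w r = K-nonempty⇒ω (K-nonempty w r)

    Greatest : List (List A) → Set
    Greatest L = ∃[ k ] ((∃[ w ] (w ∈ L × Rich w × ω w k)) × (∀ {w : List A} {j} → w ∈ L → Rich w → ω w j → j ≤ k))

    ω-greatest : ∀ L → Greatest L ⊎ (∀ {w : List A} → w ∈ L → ¬ Rich w)
    ω-greatest []      = inj₂ λ ()
    ω-greatest (w ∷ L) = insert (rich? w) (ω-greatest L)
      where
      insert-rich : Rich w → ∃[ k ] ω w k → Greatest L ⊎ (∀ {w : List A} → w ∈ L → ¬ Rich w) → Greatest (w ∷ L)
      insert-rich r (k , ωk) (inj₂ none) = k , (w , here refl , r , ωk) , λ where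
        (here refl) _ ωj → ≤-reflexive (isMin-unique ωj ωk)
        (there ∈L) r _   → ⊥-elim (none ∈L r)
      insert-rich r (k , ωk) (inj₁ (k′ , (v , v∈ , rest) , max)) with ≤-total k k′
      ... | inj₁ k≤k′ = k′ , (v , there v∈ , rest) , λ where
        (here refl) _ ωj → ≤-trans (≤-reflexive (isMin-unique ωj ωk)) k≤k′
        (there ∈L)       → max ∈L
      ... | inj₂ k′≤k = k , (w , here refl , r , ωk) , λ where
        (here refl) _ ωj → ≤-reflexive (isMin-unique ωj ωk)
        (there ∈L) r ωj  → ≤-trans (max ∈L r ωj) k′≤k
      insert : Dec (Rich w) → Greatest L ⊎ (∀ {w : List A} → w ∈ L → ¬ Rich w) →
        Greatest (w ∷ L) ⊎ (∀ {v} → v ∈ w ∷ L → ¬ Rich v)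
      insert (yes r) greatest = inj₁ (insert-rich r (ω-defined w r) greatest)
      insert (no ¬r) (inj₁ (k , (v , v∈ , rest) , max)) = inj₁ (k , (v , there v∈ , rest) , λ where
        (here refl) r _ → ⊥-elim (¬r r)
        (there ∈L)      → max ∈L)
      insert (no ¬r) (inj₂ none) = inj₂ λ { (here refl) → ¬r ; (there ∈L) → none ∈L }

    -- The word `w` shows that the maximum ranges over a nonempty set, and `ω` of `w`, the length of
    -- a member of `K w`, is one of the compared values.
    φ-bound : ∀ {w : List A} {m} → Rich w → (∀ {u} → K w u → m ≤ length u) → ∃[ p ] (φ A (length w) p × m ≤ p)
    φ-bound {w} {m} r bound = conclude (ω-greatest (words (length w))) (ω-defined w r)
      where
      conclude : Greatest (words (length w)) ⊎ (∀ {v} → v ∈ words (length w) → ¬ Rich v) → ∃[ k ] ω w k →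
        ∃[ p ] (φ A (length w) p × m ≤ p)
      conclude (inj₂ none) _ = ⊥-elim (none (∈-words w) r)
      conclude (inj₁ (p , (v , v∈ , rv , ωv) , max)) (k , ωk@((u , Ku , |u|≡k) , _)) =
        p , ((λ w′ r′ _ → ω-defined w′ r′) , (v , rv , length-words _ v∈ , ωv) , below)
        , ≤-trans (bound Ku) (≤-trans (≤-reflexive |u|≡k) (max (∈-words w) r ωk))
        where
        below : ∀ k → ∃[ w′ ] (Rich w′ × length w′ ≡ length w × ω w′ k) → k ≤ p
        below k (w′ , r′ , len , ωk) = max (subst (λ n → w′ ∈ words n) len (∈-words w′)) r′ ωk

-- The interleaving map

pattern 𝟘 = false
pattern 𝟙 = true

-- On nonempty words `τ` and `ψ` are `σ` with an extra separating zero in front or at the end.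
τ ψ σ : List Bool → List Bool
τ []      = []
τ (x ∷ w) = 𝟘 ∷ not x ∷ τ w
ψ []      = []
ψ (x ∷ w) = not x ∷ 𝟘 ∷ ψ w
σ []      = []
σ (x ∷ w) = not x ∷ τ w

-- The exceptional words: their images are runs of zeros, in which image letters and separators look
-- alike.
Ones : List Bool → Set
Ones = All (_≡ 𝟙)

τ-++ : ∀ u v → τ (u ++ v) ≡ τ u ++ τ v
τ-++ []      v = refl
τ-++ (x ∷ u) v = cong (λ w → 𝟘 ∷ not x ∷ w) (τ-++ u v)

ψ-++ : ∀ u v → ψ (u ++ v) ≡ ψ u ++ ψ v
ψ-++ []      v = refl
ψ-++ (x ∷ u) v = cong (λ w → not x ∷ 𝟘 ∷ w) (ψ-++ u v)

σ-++ : ∀ u c v → σ (u ++ c ∷ v) ≡ ψ u ++ σ (c ∷ v)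
σ-++ []          c v = refl
σ-++ (x ∷ [])    c v = refl
σ-++ (x ∷ y ∷ u) c v = cong (λ w → not x ∷ 𝟘 ∷ w) (σ-++ (y ∷ u) c v)

τ-∷ʳ𝟘 : ∀ w → τ w ∷ʳ 𝟘 ≡ 𝟘 ∷ ψ w
τ-∷ʳ𝟘 []      = refl
τ-∷ʳ𝟘 (x ∷ w) = cong (λ v → 𝟘 ∷ not x ∷ v) (τ-∷ʳ𝟘 w)

σ-∷ʳ𝟘 : ∀ x w → σ (x ∷ w) ∷ʳ 𝟘 ≡ ψ (x ∷ w)
σ-∷ʳ𝟘 x w = cong (not x ∷_) (τ-∷ʳ𝟘 w)

reverse-∷∷ : ∀ {A : Set} (x y : A) w → reverse (x ∷ y ∷ w) ≡ reverse w ++ y ∷ x ∷ []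
reverse-∷∷ x y w = trans (unfold-reverse x (y ∷ w))
  (trans (cong (_∷ʳ x) (unfold-reverse y w)) (++-assoc (reverse w) [ y ] [ x ]))

reverse-τ : ∀ w → reverse (τ w) ≡ ψ (reverse w)
reverse-τ []      = refl
reverse-τ (x ∷ w) = begin
  reverse (𝟘 ∷ not x ∷ τ w)            ≡⟨ reverse-∷∷ 𝟘 (not x) (τ w) ⟩
  reverse (τ w) ++ not x ∷ 𝟘 ∷ []      ≡⟨ cong (_++ not x ∷ 𝟘 ∷ []) (reverse-τ w) ⟩
  ψ (reverse w) ++ ψ [ x ]             ≡⟨ ψ-++ (reverse w) [ x ] ⟨
  ψ (reverse w ∷ʳ x)                   ≡⟨ cong ψ (unfold-reverse x w) ⟨
  ψ (reverse (x ∷ w))                  ∎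
  where open ≡-Reasoning

reverse-ψ : ∀ w → reverse (ψ w) ≡ τ (reverse w)
reverse-ψ w = begin
  reverse (ψ w)                     ≡⟨ cong (reverse ∘ ψ) (reverse-involutive w) ⟨
  reverse (ψ (reverse (reverse w))) ≡⟨ cong reverse (reverse-τ (reverse w)) ⟨
  reverse (reverse (τ (reverse w))) ≡⟨ reverse-involutive (τ (reverse w)) ⟩
  τ (reverse w)                     ∎
  where open ≡-Reasoning

reverse-σ : ∀ w → reverse (σ w) ≡ σ (reverse w)
reverse-σ []      = refl
reverse-σ (x ∷ w) = begin
  reverse (not x ∷ τ w)         ≡⟨ unfold-reverse (not x) (τ w) ⟩
  reverse (τ w) ∷ʳ not x        ≡⟨ cong (_∷ʳ not x) (reverse-τ w) ⟩
  ψ (reverse w) ++ σ [ x ]      ≡⟨ σ-++ (reverse w) x [] ⟨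
  σ (reverse w ∷ʳ x)            ≡⟨ cong σ (unfold-reverse x w) ⟨
  σ (reverse (x ∷ w))           ∎
  where open ≡-Reasoning

τ-injective : ∀ {u v} → τ u ≡ τ v → u ≡ v
τ-injective {[]}    {[]}    _  = refl
τ-injective {x ∷ u} {y ∷ v} eq with e , eq′ ← ∷-injective (∷-injectiveʳ eq) =
  cong₂ _∷_ (𝔹.not-injective e) (τ-injective eq′)

σ-injective : ∀ {u v} → σ u ≡ σ v → u ≡ v
σ-injective {[]}    {[]}    _  = refl
σ-injective {x ∷ u} {y ∷ v} eq = τ-injective (cong (𝟘 ∷_) eq)

σ-palindrome : ∀ {p} → Palindrome p → Palindrome (σ p)
σ-palindrome {p} pp = trans (reverse-σ p) (cong σ pp)

σ-palindrome⁻ : ∀ {p} → Palindrome (σ p) → Palindrome p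
σ-palindrome⁻ {p} pp = σ-injective (trans (sym (reverse-σ p)) pp)

ψ≡τ⇒ones : ∀ p r → ψ p ≡ τ r → Ones p
ψ≡τ⇒ones []      _       _  = []
ψ≡τ⇒ones (𝟙 ∷ p) (y ∷ r) eq = refl ∷ ψ≡τ⇒ones p r (∷-injectiveʳ (∷-injectiveʳ eq))

-- Reversal exchanges the positions of separators and image letters in `ψ p`, so all image letters
-- must be zeros.
ψ-palindrome⇒ones : ∀ p → Palindrome (ψ p) → Ones p
ψ-palindrome⇒ones p pp = ψ≡τ⇒ones p (reverse p) (trans (sym pp) (reverse-ψ p))

ones⇒ψ≡τ : ∀ {p} → Ones p → ψ p ≡ τ p
ones⇒ψ≡τ []         = refl
ones⇒ψ≡τ (refl ∷ o) = cong (λ w → 𝟘 ∷ 𝟘 ∷ w) (ones⇒ψ≡τ o)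

ones-palindrome : ∀ {p} → Ones p → Palindrome p
ones-palindrome o = subst Palindrome (sym (power o)) (power-palindrome 𝔹._≟_ 𝟙 _)
  where
  power : ∀ {p} → Ones p → p ≡ replicate (length p) 𝟙
  power []         = refl
  power (refl ∷ o) = cong (𝟙 ∷_) (power o)

τ-factor : ∀ {p s} → Factor p s → Factor (τ p) (τ s)
τ-factor {p} f with α , β , refl ← factor-split f =
  subst (Factor (τ p)) (sym (trans (τ-++ α (p ++ β)) (cong (τ α ++_) (τ-++ p β)))) (factor (τ α) (τ p) (τ β))

σ-factor-τ : ∀ p → Factor (σ p) (τ p)
σ-factor-τ []      = factor-refl
σ-factor-τ (x ∷ p) = there factor-refl

prefix-τ : ∀ {q} t → q ≼ τ t → ∃[ p ] (p ≼ t × (q ≡ τ p ⊎ q ≡ 𝟘 ∷ ψ p))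
prefix-τ {[]}        t       _        = [] , (t , refl) , inj₁ refl
prefix-τ {_ ∷ []}    (x ∷ t) (s , eq) with refl ← ∷-injectiveˡ eq = [] , (x ∷ t , refl) , inj₂ refl
prefix-τ {_ ∷ _ ∷ q} (x ∷ t) (s , eq) with refl , eq₁ ← ∷-injective eq with refl , eq₂ ← ∷-injective eq₁
  with prefix-τ t (s , eq₂)
... | p , (r , e) , inj₁ refl = x ∷ p , (r , cong (x ∷_) e) , inj₁ refl
... | p , (r , e) , inj₂ refl = x ∷ p , (r , cong (x ∷_) e) , inj₂ refl

prefix-σ : ∀ {q} t → q ≼ σ t → ∃[ p ] (p ≼ t × (q ≡ σ p ⊎ q ≡ ψ p))
prefix-σ {[]}    t       _        = [] , (t , refl) , inj₁ refl
prefix-σ {_ ∷ q} (x ∷ t) (s , eq) with refl , eq₁ ← ∷-injective eq with prefix-τ t (s , eq₁)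
... | p , (r , e) , inj₁ refl = x ∷ p , (r , cong (x ∷_) e) , inj₁ refl
... | p , (r , e) , inj₂ refl = x ∷ p , (r , cong (x ∷_) e) , inj₂ refl

τ-prefix⁻ : ∀ p {t s} → τ t ≡ τ p ++ s → p ≼ t
τ-prefix⁻ []      {t}     _  = t , refl
τ-prefix⁻ (x ∷ p) {y ∷ t} eq with e , eq′ ← ∷-injective (∷-injectiveʳ eq) | r , e′ ← τ-prefix⁻ p (∷-injectiveʳ (∷-injectiveʳ eq)) =
  r , cong₂ _∷_ (𝔹.not-injective e) e′

σ-prefix⁻ : ∀ p {t s} → σ t ≡ σ p ++ s → p ≼ t
σ-prefix⁻ []      {t}     _  = t , refl
σ-prefix⁻ (x ∷ p) {y ∷ t} eq = τ-prefix⁻ (x ∷ p) (cong (𝟘 ∷_) eq)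

shifted⇒ones : ∀ p {t s} → τ t ≡ σ p ++ s → Ones p
shifted⇒ones []          _ = []
shifted⇒ones (𝟙 ∷ [])    _ = refl ∷ []
shifted⇒ones (𝟙 ∷ y ∷ p) {_ ∷ t} eq = refl ∷ shifted⇒ones (y ∷ p) (∷-injectiveʳ (∷-injectiveʳ eq))
shifted⇒ones (𝟘 ∷ p)     {[]}    ()
shifted⇒ones (𝟘 ∷ p)     {_ ∷ t} ()

-- Either the image letters of `σ p` meet image letters of `τ s`, which locates `p` in `s`, or they
-- meet separators and are all zeros.
σ-factor⁻ : ∀ {p} s → Factor (σ p) (τ s) → Factor p s ⊎ Ones p
σ-factor⁻ {p} s f with factor-split f
... | [] , β , eq = inj₂ (shifted⇒ones p eq)
σ-factor⁻ {p} (x ∷ s) f | _ ∷ [] , β , eq = inj₁ (≼⇒Factor (σ-prefix⁻ p {x ∷ s} (∷-injectiveʳ eq)))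
σ-factor⁻ {p} (x ∷ s) f | _ ∷ _ ∷ α , β , eq
  with σ-factor⁻ {p} s (subst (Factor (σ p)) (sym (∷-injectiveʳ (∷-injectiveʳ eq))) (factor α (σ p) β))
... | inj₁ f′ = inj₁ (there f′)
... | inj₂ o  = inj₂ o

-- A run of 2m zeros covers m consecutive image letters wherever it starts, whereas the run `σ p` of
-- 2m-1 zeros may cover only m-1.
ones-factor⁻ : ∀ {p} s → Ones p → Factor (τ p) (τ s) → Factor p s
ones-factor⁻ {p} s o f with factor-split f
... | [] , β , eq = ≼⇒Factor (τ-prefix⁻ p eq)
ones-factor⁻ {p} (x ∷ s) o f | _ ∷ [] , β , eq = ≼⇒Factor (σ-prefix⁻ p {x ∷ s} (trans (∷-injectiveʳ eq) (proj₂ (τ≡σ++ p o β))))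
  where
  τ≡σ++ : ∀ p → Ones p → ∀ β → ∃[ β′ ] τ p ++ β ≡ σ p ++ β′
  τ≡σ++ []      _ β = β , refl
  τ≡σ++ (x ∷ p) o β = 𝟘 ∷ β , (begin
    τ (x ∷ p) ++ β             ≡⟨ cong (_++ β) (ones⇒ψ≡τ o) ⟨
    ψ (x ∷ p) ++ β             ≡⟨ cong (_++ β) (σ-∷ʳ𝟘 x p) ⟨
    (σ (x ∷ p) ∷ʳ 𝟘) ++ β      ≡⟨ ++-assoc (σ (x ∷ p)) [ 𝟘 ] β ⟩
    σ (x ∷ p) ++ 𝟘 ∷ β         ∎)
    where open ≡-Reasoning
ones-factor⁻ {p} (x ∷ s) o f | _ ∷ _ ∷ α , β , eq =
  there (ones-factor⁻ s o (subst (Factor (τ p)) (sym (∷-injectiveʳ (∷-injectiveʳ eq))) (factor α (τ p) β)))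

-- Words without adjacent ones

OneOne : List Bool
OneOne = 𝟙 ∷ 𝟙 ∷ []

Sparse : List Bool → Set
Sparse w = ¬ Factor OneOne w

τ-sparse : ∀ w → Sparse (τ w)
τ-sparse []      (here ())
τ-sparse (x ∷ w) (here (() Prefix.∷ _))
τ-sparse (x ∷ w) (there (there f)) = τ-sparse w f
τ-sparse (x ∷ w) (there (here p)) = second w p
  where
  second : ∀ {y} w → ¬ Prefix.Prefix _≡_ OneOne (y ∷ τ w)
  second []      (_ Prefix.∷ ())
  second (_ ∷ w) (_ Prefix.∷ (() Prefix.∷ _))

σ-sparse : ∀ w → Sparse (σ w)
σ-sparse w f = τ-sparse w (factor-trans f (σ-factor-τ w))

-- E and C are 011001 and 011001100 read from right to left, and
-- τ C ++ E = D ++ C, so the words that start with C in reading order are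
-- mapped to such words.
Y E C D : List Bool
Y = 𝟘 ∷ 𝟘 ∷ 𝟙 ∷ 𝟙 ∷ 𝟘 ∷ []
E = 𝟙 ∷ Y
C = 𝟘 ∷ 𝟘 ∷ 𝟙 ∷ E
D = 𝟘 ∷ 𝟙 ∷ 𝟘 ∷ 𝟙 ∷ 𝟘 ∷ 𝟘 ∷ 𝟘 ∷ 𝟘 ∷ 𝟘 ∷ 𝟙 ∷ 𝟘 ∷ 𝟙 ∷ 𝟘 ∷ 𝟘 ∷ 𝟘 ∷ []

-- By the length bound the block 11 after `ρ` would lie inside the sparse prefix `L`.
sparse-compare : ∀ {w L s s′} ρ → Sparse L → w ≡ L ++ s → w ≡ ρ ++ 𝟙 ∷ 𝟙 ∷ s′ → 2 + length ρ ≤ length L → ⊥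
sparse-compare {s′ = s′} ρ sparse e e′ le
  with r , eq ← prefix-compare (trans e′ (sym (++-assoc ρ OneOne s′))) e
         (≤-trans (≤-reflexive (trans (length-++ ρ) (+-comm (length ρ) 2))) le) =
  sparse (subst (Factor OneOne) (sym (trans eq (++-assoc ρ OneOne r))) (factor ρ OneOne r))

-- A palindrome containing 11 shows it again at the mirrored place, `length r` letters from the
-- head.
mirror : ∀ M r → Palindrome (M ++ 𝟙 ∷ 𝟙 ∷ r) → M ++ 𝟙 ∷ 𝟙 ∷ r ≡ reverse r ++ 𝟙 ∷ 𝟙 ∷ reverse M
mirror M r pal = begin
  M ++ 𝟙 ∷ 𝟙 ∷ r                          ≡⟨ pal ⟨
  reverse (M ++ 𝟙 ∷ 𝟙 ∷ r)                ≡⟨ reverse-++ M (𝟙 ∷ 𝟙 ∷ r) ⟩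
  reverse (𝟙 ∷ 𝟙 ∷ r) ++ reverse M        ≡⟨ cong (_++ reverse M) (reverse-∷∷ 𝟙 𝟙 r) ⟩
  (reverse r ++ OneOne) ++ reverse M      ≡⟨ ++-assoc (reverse r) OneOne (reverse M) ⟩
  reverse r ++ 𝟙 ∷ 𝟙 ∷ reverse M          ∎
  where open ≡-Reasoning

sparse-prefix : ∀ {q} M Z → q ≼ M ++ 𝟙 ∷ 𝟙 ∷ Z → Sparse q → q ≼ M ∷ʳ 𝟙
sparse-prefix {q} M Z (s , eq) sparse
  with ++-split q (M ∷ʳ 𝟙) (sym (trans (++-assoc M [ 𝟙 ] (𝟙 ∷ Z)) eq))
... | inj₁ (δ , e , _) = δ , e
... | inj₂ (c , δ , e , e′) with refl ← ∷-injectiveˡ e′ =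
  ⊥-elim (sparse (subst (Factor OneOne) (sym (trans e (++-assoc M [ 𝟙 ] (𝟙 ∷ δ)))) (factor M OneOne δ)))

-- A factor without 11 cannot contain both ones of the block, so it ends at the first or starts at
-- the second at the latest.
sparse-split : ∀ {q} M {Z} → Factor q (M ++ 𝟙 ∷ 𝟙 ∷ Z) → Sparse q → Factor q (M ∷ʳ 𝟙) ⊎ Factor q (𝟙 ∷ Z)
sparse-split {q} M {Z} f sparse with factor-split f
... | [] , β , eq = inj₁ (≼⇒Factor (sparse-prefix M Z (β , eq) sparse))
sparse-split {q} []      f sparse | _ ∷ α , β , eq = inj₂ (subst (Factor q) (sym (∷-injectiveʳ eq)) (factor α q β))
sparse-split {q} (x ∷ M) f sparse | _ ∷ α , β , eq
  with sparse-split M (subst (Factor q) (sym (∷-injectiveʳ eq)) (factor α q β)) sparse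
... | inj₁ g = inj₁ (there g)
... | inj₂ g = inj₂ g

length-τ : ∀ w → length (τ w) ≡ 2 * length w
length-τ []      = refl
length-τ (x ∷ w) = trans (cong (λ n → suc (suc n)) (length-τ w)) (sym (*-suc 2 (length w)))

length-ψ : ∀ w → length w ≤ length (ψ w)
length-ψ []      = z≤n
length-ψ (x ∷ w) = s≤s (m≤n⇒m≤1+n (length-ψ w))

-- Letters blocked after an interleaved word

σ-∷ʳ : ∀ s → σ (s ∷ʳ 𝟘) ≡ ψ s ∷ʳ 𝟙
σ-∷ʳ s = σ-++ s 𝟘 []

τ-∷ʳ : ∀ s → τ (s ∷ʳ 𝟘) ≡ (τ s ∷ʳ 𝟘) ∷ʳ 𝟙
τ-∷ʳ s = trans (τ-++ s [ 𝟘 ]) (sym (++-assoc (τ s) [ 𝟘 ] [ 𝟙 ]))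

junction : ∀ M → (M ∷ʳ 𝟙) ++ E ≡ M ++ 𝟙 ∷ 𝟙 ∷ Y
junction M = ++-assoc M [ 𝟙 ] E

after-junction : ∀ (δ r : List Bool) {x} → E ≡ x ∷ δ ++ r → x ≡ 𝟙 × length δ ≤ 5
after-junction δ r eq = sym (∷-injectiveˡ eq)
  , ≤-trans (m≤m+n (length δ) (length r)) (≤-reflexive (trans (sym (length-++ δ)) (cong length (sym (∷-injectiveʳ eq)))))

-- Enforces the separating zero. A nonempty palindrome within `𝟙 ∷ σ w` can only be 1, 11 or 1001,
-- all factors of `E`; one that reaches into `E` contains the block 11 at the junction and would
-- have to mirror it.
blocked-𝟙 : ∀ {w} s → w ≡ s ∷ʳ 𝟘 → 5 ≤ length s → ¬ Palindrome w → ¬ OneOne ≼ w → ¬ New 𝟙 (σ w ++ E)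
blocked-𝟙 {w} s w≡ long ¬pal ¬11 (q , pq , (r , eq) , ¬f) with ++-split q (𝟙 ∷ σ w) (sym eq)
blocked-𝟙 {w} s w≡ long ¬pal ¬11 ([]    , pq , (r , eq) , ¬f) | inj₁ (δ , e , _) = ¬f (factor [] [] _)
blocked-𝟙 {w} s w≡ long ¬pal ¬11 (_ ∷ q , pq , (r , eq) , ¬f) | inj₁ (δ , e , _)
  with refl , e′ ← ∷-injective e with prefix-σ w (δ , e′)
... | p , p≼w , q≡ with initLast p
...   | [] = ¬f (σ w ++ⁱ subst (λ u → Factor (𝟙 ∷ u) E) (sym (reduce q≡)) (from-yes (factor? 𝔹._≟_ [ 𝟙 ] E)))
...   | p₀ ∷ʳ′ x with q≡
...     | inj₂ refl with () ← palindrome-ends (subst (λ u → Palindrome (𝟙 ∷ u)) (trans (ψ-++ p₀ [ x ]) (sym (++-assoc (ψ p₀) [ not x ] [ 𝟘 ]))) pq)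
...     | inj₁ refl = ¬f (σ w ++ⁱ subst (λ u → Factor (𝟙 ∷ u) E) (sym (σ-++ p₀ x [])) (short (ψ-palindrome⇒ones p₀ (palindrome-wrap⁻ pq′)) (palindrome-ends pq′) p₀≼w))
  where
  pq′ : Palindrome (𝟙 ∷ ψ p₀ ∷ʳ not x)
  pq′ = subst (λ u → Palindrome (𝟙 ∷ u)) (σ-++ p₀ x []) pq
  p₀≼w : p₀ ≼ w
  p₀≼w = let r , e = p≼w in x ∷ r , trans e (++-assoc p₀ [ x ] r)
  -- Since `w` does not begin with 11, `p` is empty or a single 1, which leaves the palindromes 11
  -- and 1001.
  short : ∀ {p x} → Ones p → 𝟙 ≡ not x → p ≼ w → Factor (𝟙 ∷ ψ p ∷ʳ not x) E
  short {x = 𝟘} []                _ _       = from-yes (factor? 𝔹._≟_ OneOne E)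
  short {x = 𝟘} (refl ∷ [])       _ _       = from-yes (factor? 𝔹._≟_ (𝟙 ∷ 𝟘 ∷ 𝟘 ∷ 𝟙 ∷ []) E)
  short         (refl ∷ refl ∷ _) _ (r , e) = ⊥-elim (¬11 (_ , e))
blocked-𝟙 {w} s w≡ long ¬pal ¬11 (q , pq , (r , eq) , ¬f) | inj₂ (c , δ , q≡ , e)
  with refl , short ← after-junction δ r e = no-mirror δ short (subst Palindrome q≡′ pq)
  where
  σw≡ : σ w ≡ ψ s ∷ʳ 𝟙
  σw≡ = trans (cong σ w≡) (σ-∷ʳ s)
  q≡′ : q ≡ (𝟙 ∷ ψ s) ++ 𝟙 ∷ 𝟙 ∷ δ
  q≡′ = trans q≡ (cong (𝟙 ∷_) (trans (cong (_++ 𝟙 ∷ δ) σw≡) (++-assoc (ψ s) [ 𝟙 ] (𝟙 ∷ δ))))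
  no-mirror : ∀ δ → length δ ≤ 5 → Palindrome ((𝟙 ∷ ψ s) ++ 𝟙 ∷ 𝟙 ∷ δ) → ⊥
  -- With `δ` empty the palindrome is `σ w` between two ones, and `w` would be a palindrome.
  no-mirror []      _ pal = ¬pal (σ-palindrome⁻ (subst Palindrome (sym σw≡)
    (palindrome-wrap⁻ (subst (λ u → Palindrome (𝟙 ∷ u)) (sym (++-assoc (ψ s) [ 𝟙 ] [ 𝟙 ])) pal))))
  -- The mirrored block 11 starts between one and five letters from the head, hence inside the
  -- sparse word `σ w`.
  no-mirror (d ∷ δ) le pal = go (reverse (d ∷ δ)) (length-reverse (d ∷ δ)) (mirror (𝟙 ∷ ψ s) (d ∷ δ) pal)
    where
    go : ∀ ρ → length ρ ≡ suc (length δ) → 𝟙 ∷ ψ s ++ 𝟙 ∷ 𝟙 ∷ d ∷ δ ≡ ρ ++ 𝟙 ∷ 𝟙 ∷ reverse (𝟙 ∷ ψ s) → ⊥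
    go (_ ∷ ρ) len m = sparse-compare ρ (subst Sparse σw≡ (σ-sparse w))
      (sym (++-assoc (ψ s) [ 𝟙 ] (𝟙 ∷ d ∷ δ))) (∷-injectiveʳ m)
      (≤-trans (s≤s (≤-trans (≤-reflexive len) (≤-trans le (≤-trans long (length-ψ s)))))
        (≤-reflexive (sym (trans (length-++ (ψ s)) (+-comm (length (ψ s)) 1)))))

-- A palindrome within `σ (y ∷ w)` is `σ p` or `ψ p` for a palindromic prefix `p` of `y ∷ w`; as `y`
-- is blocked, `p` occurs in `w` and its image in `τ w`. A palindrome reaching into `E` would mirror
-- the junction into a sparse word.
blocked-not : ∀ {w y} s → w ≡ s ∷ʳ 𝟘 → 5 ≤ length s → ¬ New y w → ¬ New (not y) (τ w ++ E)
blocked-not {w} {y} s w≡ long ¬new (q , pq , (r , eq) , ¬f) with ++-split q (σ (y ∷ w)) (sym eq)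
... | inj₁ (δ , e , _) with prefix-σ (y ∷ w) (δ , e)
...   | p , p≼ , inj₁ refl = ¬f (factor-trans (σ-factor-τ p) (τ-factor p⊆w) ⁱ++ E)
  where p⊆w = decidable-stable (factor? 𝔹._≟_ p w) λ ¬p → ¬new (p , σ-palindrome⁻ pq , p≼ , ¬p)
...   | p , p≼ , inj₂ refl = ¬f (subst (λ u → Factor u _) (sym (ones⇒ψ≡τ o)) (τ-factor p⊆w ⁱ++ E))
  where
  o = ψ-palindrome⇒ones p pq
  p⊆w = decidable-stable (factor? 𝔹._≟_ p w) λ ¬p → ¬new (p , ones-palindrome o , p≼ , ¬p)
blocked-not {w} {y} s w≡ long ¬new (q , pq , (r , eq) , ¬f) | inj₂ (c , δ , q≡ , e)
  with refl , short ← after-junction δ r e =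
  sparse-compare (reverse δ) (subst Sparse σ≡ (σ-sparse (y ∷ w))) (sym (++-assoc (ψ (y ∷ s)) [ 𝟙 ] (𝟙 ∷ δ)))
    (mirror (ψ (y ∷ s)) δ (subst Palindrome q≡′ pq))
    (≤-trans (s≤s (s≤s (≤-trans (≤-reflexive (length-reverse δ)) (≤-trans short (≤-trans long (length-ψ s))))))
      (≤-trans (n≤1+n _) (≤-reflexive (sym (trans (length-++ (ψ (y ∷ s))) (+-comm (length (ψ (y ∷ s))) 1))))))
  where
  σ≡ : σ (y ∷ w) ≡ ψ (y ∷ s) ∷ʳ 𝟙
  σ≡ = trans (cong (λ u → σ (y ∷ u)) w≡) (σ-∷ʳ (y ∷ s))
  q≡′ : q ≡ ψ (y ∷ s) ++ 𝟙 ∷ 𝟙 ∷ δ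
  q≡′ = trans q≡ (trans (cong (_++ 𝟙 ∷ δ) σ≡) (++-assoc (ψ (y ∷ s)) [ 𝟙 ] (𝟙 ∷ δ)))

-- Richness of interleaved words

small-factor : ∀ p → Factor (σ p) E → Factor p C
-- Ensures that the image of a new palindrome does not occur in `E` by accident. As `E` has six
-- letters, `p` has at most three.
small-factor p f = cases p f (length-mono f)
  where
  cases : ∀ p → Factor (σ p) E → length (σ p) ≤ 6 → Factor p C
  cases []                  f _ = factor [] [] C
  cases w@(𝟘 ∷ [])            f _ = from-yes (factor? 𝔹._≟_ w C)
  cases w@(𝟙 ∷ [])            f _ = from-yes (factor? 𝔹._≟_ w C)
  cases w@(𝟘 ∷ 𝟘 ∷ [])        f _ = from-yes (factor? 𝔹._≟_ w C)
  cases w@(𝟘 ∷ 𝟙 ∷ [])        f _ = from-yes (factor? 𝔹._≟_ w C)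
  cases w@(𝟙 ∷ 𝟘 ∷ [])        f _ = from-yes (factor? 𝔹._≟_ w C)
  cases w@(𝟙 ∷ 𝟙 ∷ [])        f _ = from-yes (factor? 𝔹._≟_ w C)
  cases w@(𝟘 ∷ 𝟘 ∷ 𝟘 ∷ [])    f _ = ⊥-elim (from-no (factor? 𝔹._≟_ (σ w) E) f)
  cases w@(𝟘 ∷ 𝟘 ∷ 𝟙 ∷ [])    f _ = from-yes (factor? 𝔹._≟_ w C)
  cases w@(𝟘 ∷ 𝟙 ∷ 𝟘 ∷ [])    f _ = ⊥-elim (from-no (factor? 𝔹._≟_ (σ w) E) f)
  cases w@(𝟘 ∷ 𝟙 ∷ 𝟙 ∷ [])    f _ = from-yes (factor? 𝔹._≟_ w C)
  cases w@(𝟙 ∷ 𝟘 ∷ 𝟘 ∷ [])    f _ = from-yes (factor? 𝔹._≟_ w C)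
  cases w@(𝟙 ∷ 𝟘 ∷ 𝟙 ∷ [])    f _ = ⊥-elim (from-no (factor? 𝔹._≟_ (σ w) E) f)
  cases w@(𝟙 ∷ 𝟙 ∷ 𝟘 ∷ [])    f _ = from-yes (factor? 𝔹._≟_ w C)
  cases w@(𝟙 ∷ 𝟙 ∷ 𝟙 ∷ [])    f _ = ⊥-elim (from-no (factor? 𝔹._≟_ (σ w) E) f)
  cases (_ ∷ _ ∷ _ ∷ _ ∷ _) f (s≤s (s≤s (s≤s (s≤s (s≤s (s≤s ()))))))

module _ {x w p c r} (s : List Bool) (w≡ : w ≡ s ∷ʳ 𝟘) (C⊆w : ∀ {q} → Factor q C → Factor q w)
  (pp : Palindrome p) (eq : x ∷ w ≡ p ++ c ∷ r) (fresh : ¬ Factor p w) where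

  private
    τw≡ : τ w ≡ (τ s ∷ʳ 𝟘) ∷ʳ 𝟙
    τw≡ = trans (cong τ w≡) (τ-∷ʳ s)

    τw++E : τ w ++ E ≡ (τ s ∷ʳ 𝟘) ++ 𝟙 ∷ 𝟙 ∷ Y
    τw++E = trans (cong (_++ E) τw≡) (junction (τ s ∷ʳ 𝟘))

    split : ∀ {q} → Sparse q → Factor q (τ w ++ E) → Factor q (τ w) ⊎ Factor q E
    split sparse f with sparse-split (τ s ∷ʳ 𝟘) (subst (Factor _) τw++E f) sparse
    ... | inj₁ g = inj₁ (subst (Factor _) (sym τw≡) g)
    ... | inj₂ g = inj₂ g

    σxw≡ : σ (x ∷ w) ++ E ≡ ψ p ++ σ (c ∷ r) ++ E
    σxw≡ = trans (cong (λ u → σ u ++ E) eq) (trans (cong (_++ E) (σ-++ p c r)) (++-assoc (ψ p) (σ (c ∷ r)) E))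

    ψp≡ : ψ p ≡ σ p ∷ʳ 𝟘
    ψp≡ = nonempty p fresh
      where
      nonempty : ∀ p → ¬ Factor p w → ψ p ≡ σ p ∷ʳ 𝟘
      nonempty []      ¬f = ⊥-elim (¬f (factor [] [] w))
      nonempty (d ∷ p) _  = sym (σ-∷ʳ𝟘 d p)

    -- Having no 11, `σ p` cannot straddle the junction: it lies in `E`, so that `p` occurs in `C`,
    -- or in `τ w`, so that `σ-factor⁻` applies.
    σ-fresh : ¬ Ones p → ¬ Factor (σ p) (τ w ++ E)
    σ-fresh ¬ones f with split (σ-sparse p) f
    ... | inj₂ g = fresh (C⊆w (small-factor p g))
    ... | inj₁ g with σ-factor⁻ w g
    ...   | inj₁ p⊆w  = fresh p⊆w
    ...   | inj₂ ones = ¬ones ones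

    τ-fresh : Ones p → ¬ Factor (τ p) (τ w ++ E)
    τ-fresh ones f with split (τ-sparse p) f
    ... | inj₁ g = fresh (ones-factor⁻ w ones g)
    ... | inj₂ g = fresh (C⊆w (small-factor p (factor-trans (σ-factor-τ p) g)))

    τ-ones : Ones p → Palindrome (τ p)
    τ-ones ones = trans (reverse-τ p) (trans (cong ψ pp) (ones⇒ψ≡τ ones))

    𝟘τ-ones : Ones p → Palindrome (𝟘 ∷ τ p)
    𝟘τ-ones ones = trans (unfold-reverse 𝟘 (τ p)) (trans (cong (_∷ʳ 𝟘) (τ-ones ones))
      (trans (τ-∷ʳ𝟘 p) (cong (𝟘 ∷_) (ones⇒ψ≡τ ones))))

  -- σ p is new, except that for p = 1^m the word σ p = 0^(2m-1) may already
  -- occur between two letters 1, and 0^(2m) takes its place.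
  new-not-𝟘 : New (not x) (τ w ++ E) × New 𝟘 (σ (x ∷ w) ++ E)
  new-not-𝟘 with All.all? (𝔹._≟ 𝟙) p
  ... | yes ones =
    (τ p , τ-ones ones , (_ , σxw≡′) , τ-fresh ones)
    , (𝟘 ∷ τ p , 𝟘τ-ones ones , (_ , cong (𝟘 ∷_) σxw≡′) , λ f → case factor-split f of λ where
        (α , β , e) → τ-fresh ones (factor-tail 𝟘 {α} {τ p} {β} (trans e (sym (++-assoc α [ 𝟘 ] (τ p ++ β))))))
    where
    σxw≡′ : σ (x ∷ w) ++ E ≡ τ p ++ σ (c ∷ r) ++ E
    σxw≡′ = trans σxw≡ (cong (_++ σ (c ∷ r) ++ E) (ones⇒ψ≡τ ones))
  ... | no ¬ones =
    (σ p , σ-palindrome pp , (_ , σxw≡′) , σ-fresh ¬ones)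
    , (𝟘 ∷ σ p ∷ʳ 𝟘 , palindrome-wrap 𝟘 (σ-palindrome pp)
      , (_ , cong (𝟘 ∷_) (trans σxw≡ (cong (_++ σ (c ∷ r) ++ E) ψp≡)))
      , onlyAtHead-wrap 𝟘 (λ e → subst (λ u → ¬ Factor (σ p) u) (∷-injectiveʳ e) (σ-fresh ¬ones)))
    where
    σxw≡′ : σ (x ∷ w) ++ E ≡ σ p ++ 𝟘 ∷ σ (c ∷ r) ++ E
    σxw≡′ = trans σxw≡ (trans (cong (_++ σ (c ∷ r) ++ E) ψp≡) (++-assoc (σ p) [ 𝟘 ] _))

-- The word `C` is both `B ++ E` and `C⁻ ∷ʳ 𝟘`. Sparsity of `L ++ B` confines the blocks 11 of
-- `L ++ C` to the junction with `E` and to `E` itself.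
B C⁻ : List Bool
B  = 𝟘 ∷ 𝟘 ∷ 𝟙 ∷ []
C⁻ = 𝟘 ∷ 𝟘 ∷ 𝟙 ∷ 𝟙 ∷ 𝟘 ∷ 𝟘 ∷ 𝟙 ∷ 𝟙 ∷ []

-- The reversal of `C` begins with 011, while the first three letters of `L ++ C` contain no 11.
sparse⇒¬palindrome : ∀ L → Sparse (L ++ B) → ¬ Palindrome (L ++ C)
sparse⇒¬palindrome L sparse pal = sparse-compare [ 𝟘 ] sparse
  (sym (++-assoc L B E)) (trans (sym pal) (reverse-++ L C))
  (≤-trans (m≤n+m 3 (length L)) (≤-reflexive (sym (length-++ L))))

sparse⇒¬𝟙𝟙 : ∀ L → Sparse (L ++ B) → ¬ OneOne ≼ L ++ C
sparse⇒¬𝟙𝟙 L sparse (r , eq) = sparse-compare [] sparse (sym (++-assoc L B E)) eq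
  (≤-trans (≤-trans (n≤1+n 2) (m≤n+m 3 (length L))) (≤-reflexive (sym (length-++ L))))

C-ends-𝟘 : ∀ L → L ++ C ≡ (L ++ C⁻) ∷ʳ 𝟘
C-ends-𝟘 L = sym (++-assoc L C⁻ [ 𝟘 ])

long : ∀ L → 5 ≤ length (L ++ C⁻)
long L = ≤-trans (≤-trans (m≤m+n 5 3) (m≤n+m 8 (length L))) (≤-reflexive (sym (length-++ L)))

-- Every letter adds two, its image and a separating zero. Since `x ∷ L ++ C` is no palindrome, its
-- new palindrome is followed by a letter `c`, as `new-not-𝟘` requires.
stepRich-τ : ∀ L → Sparse (L ++ B) → StepRich (L ++ C) → StepRich (τ (L ++ C) ++ E)
stepRich-τ []      _      _                             = from-yes (stepRich? 𝔹._≟_ (τ C ++ E))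
stepRich-τ (x ∷ L) sparse ((p , pp , ([] , eq) , f) , r) =
  ⊥-elim (sparse⇒¬palindrome (x ∷ L) sparse (subst Palindrome (sym (trans eq (++-identityʳ p))) pp))
stepRich-τ (x ∷ L) sparse ((p , pp , (c ∷ s , eq) , f) , r)
  with new₁ , new₂ ← new-not-𝟘 (L ++ C⁻) (C-ends-𝟘 L) (L ++ⁱ_) pp eq f =
  new₂ , new₁ , stepRich-τ L (sparse ∘ there) r

-- Forced extensions of binary words

-- Over two letters, blocking `not x` forces `x`. The words are stored without their common oldest
-- part `C`.
data Chain (L₀ : List Bool) : ℕ → List Bool → Set where
  start : Chain L₀ 0 L₀
  step  : ∀ {m x L} → Chain L₀ m L → ¬ New (not x) (L ++ C) → Chain L₀ (suc m) (x ∷ L)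

chain-sparse : ∀ {L₀ m L} → Chain L₀ m L → Sparse (L ++ B) → Sparse (L₀ ++ B)
chain-sparse start      sparse = sparse
chain-sparse (step c _) sparse = chain-sparse c (sparse ∘ there)

-- Images with the oldest part `C` split off: `σ′ L ++ C` is `σ (L ++ C) ++ E`. For the empty word,
-- `σ′` is `D` without its leading zero.
σ′ τ′ : List Bool → List Bool
σ′ []      = 𝟙 ∷ 𝟘 ∷ 𝟙 ∷ 𝟘 ∷ 𝟘 ∷ 𝟘 ∷ 𝟘 ∷ 𝟘 ∷ 𝟙 ∷ 𝟘 ∷ 𝟙 ∷ 𝟘 ∷ 𝟘 ∷ 𝟘 ∷ []
σ′ (x ∷ L) = not x ∷ τ L ++ D
τ′ L       = τ L ++ D

𝟘∷σ′ : ∀ L → 𝟘 ∷ σ′ L ≡ τ′ L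
𝟘∷σ′ []      = refl
𝟘∷σ′ (x ∷ L) = refl

τ′-++C : ∀ L → τ′ L ++ C ≡ τ (L ++ C) ++ E
τ′-++C L = begin
  (τ L ++ D) ++ C      ≡⟨ ++-assoc (τ L) D C ⟩
  τ L ++ τ C ++ E      ≡⟨ ++-assoc (τ L) (τ C) E ⟨
  (τ L ++ τ C) ++ E    ≡⟨ cong (_++ E) (τ-++ L C) ⟨
  τ (L ++ C) ++ E      ∎
  where open ≡-Reasoning

σ′-++C : ∀ L → σ′ L ++ C ≡ σ (L ++ C) ++ E
σ′-++C []      = refl
σ′-++C (x ∷ L) = ∷-injectiveʳ (τ′-++C (x ∷ L))

τ′-sparse : ∀ L → Sparse (τ′ L ++ B)
τ′-sparse L = subst Sparse (trans (τ-++ L C) (sym (++-assoc (τ L) D B))) (τ-sparse (L ++ C))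

-- The word `σ′ L₀` ends on an image letter, so a separator is forced at once; each letter of the
-- old chain then forces its image and another separator.
chain-τ : ∀ {L₀ m L} → Sparse (L ++ B) → Chain L₀ m L → Chain (σ′ L₀) (suc (2 * m)) (τ′ L)
chain-τ {L₀} sparse start = subst (Chain (σ′ L₀) 1) (𝟘∷σ′ L₀) (step start (not-𝟙 L₀ sparse))
  where
  not-𝟙 : ∀ L → Sparse (L ++ B) → ¬ New 𝟙 (σ′ L ++ C)
  not-𝟙 L sparse = subst (λ w → ¬ New 𝟙 w) (sym (σ′-++C L))
    (blocked-𝟙 (L ++ C⁻) (C-ends-𝟘 L) (long L) (sparse⇒¬palindrome L sparse) (sparse⇒¬𝟙𝟙 L sparse))
chain-τ {L₀} {suc m} {x ∷ L} sparse (step c ¬new) =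
  subst (λ n → Chain (σ′ L₀) (suc n) (τ′ (x ∷ L))) (sym (*-suc 2 m))
    (step (step (chain-τ (sparse ∘ there) c)
      (subst (λ w → ¬ New (not (not x)) w) (sym (τ′-++C L)) (blocked-not (L ++ C⁻) (C-ends-𝟘 L) (long L) ¬new)))
      (subst (λ w → ¬ New 𝟙 w) (sym (σ′-++C (x ∷ L)))
        (blocked-𝟙 (x ∷ L ++ C⁻) (C-ends-𝟘 (x ∷ L)) (long (x ∷ L)) (sparse⇒¬palindrome (x ∷ L) sparse) (sparse⇒¬𝟙𝟙 (x ∷ L) sparse))))

-- The summand 2k of ratio makes room for the letters other than 0 and 1.
record Stage (k : ℕ) : Set where
  field
    {L₀ L} : List Bool
    {m}    : ℕ
    chain  : Chain L₀ m L
    sparse : Sparse (L ++ B)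
    rich   : StepRich (L₀ ++ C)
    large  : k < length (L₀ ++ C)
    ratio  : 2 * (length (L₀ ++ C) + 5) + (4 + 2 * k) ≤ 9 * suc m

next : ∀ {k} → Stage k → Stage (suc k)
next {k} st = record
  { chain  = chain-τ sparse chain
  ; sparse = τ′-sparse L
  -- The newest separating zero is removed, so that it counts as the first forced letter.
  ; rich   = proj₂ (subst StepRich (sym 𝟘σ′) (stepRich-τ L₀ (chain-sparse chain sparse) rich))
  ; large  = ≤-trans (s≤s large) (≤-trans (m≤n+m (suc n) (n + 4)) (≤-reflexive (trans (grow n) (sym len))))
  ; ratio  = begin
      2 * (length (σ′ L₀ ++ C) + 5) + (4 + 2 * suc k)  ≡⟨ cong (λ l → 2 * (l + 5) + (4 + 2 * suc k)) len ⟩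
      -- Doubling turns the slack 4 + 2k into 8 + 4k, which exceeds the required 6 + 2k by 2 + 2k.
      2 * ((2 * n + 5) + 5) + (4 + 2 * suc k)          ≤⟨ m≤m+n _ (2 + 2 * k) ⟩
      2 * ((2 * n + 5) + 5) + (4 + 2 * suc k) + (2 + 2 * k) ≡⟨ double n k ⟩
      2 * (2 * (n + 5) + (4 + 2 * k))                  ≤⟨ *-monoʳ-≤ 2 ratio ⟩
      2 * (9 * suc m)                                  ≡⟨ double′ m ⟩
      9 * suc (suc (2 * m))                            ∎
  }
  where
  open Stage st
  open ≤-Reasoning
  n = length (L₀ ++ C)
  𝟘σ′ : 𝟘 ∷ σ′ L₀ ++ C ≡ τ (L₀ ++ C) ++ E
  𝟘σ′ = trans (cong (_++ C) (𝟘∷σ′ L₀)) (τ′-++C L₀)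
  len : length (σ′ L₀ ++ C) ≡ 2 * n + 5
  len = suc-injective (trans (cong length 𝟘σ′) (trans (length-++ (τ (L₀ ++ C)))
    (trans (cong (_+ 6) (length-τ (L₀ ++ C))) (+-suc (2 * n) 5))))
  grow : ∀ n → n + 4 + suc n ≡ 2 * n + 5
  grow = solve-∀
  double : ∀ n k → 2 * ((2 * n + 5) + 5) + (4 + 2 * suc k) + (2 + 2 * k) ≡ 2 * (2 * (n + 5) + (4 + 2 * k))
  double = solve-∀
  double′ : ∀ m → 2 * (9 * suc m) ≡ 9 * suc (suc (2 * m))
  double′ = solve-∀

-- A decidable counterpart of `Chain`, by which the forced letters of `seed` are checked by
-- evaluation.
Blocks : List Bool → List Bool → Set
Blocks []      L = ⊤
Blocks (x ∷ u) L = ¬ New (not x) ((u ++ L) ++ C) × Blocks u L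

blocks? : ∀ u L → Dec (Blocks u L)
blocks? []      L = yes tt
blocks? (x ∷ u) L = ¬? (new? 𝔹._≟_ (not x) ((u ++ L) ++ C)) ×-dec blocks? u L

blocks⇒chain : ∀ u {L} → Blocks u L → Chain L (length u) (u ++ L)
blocks⇒chain []      _        = start
blocks⇒chain (x ∷ u) (b , bs) = step (blocks⇒chain u bs) b

-- Read from right to left, L ++ C is 011001 followed by the image under σ of
-- 011010001000100100001, and the forced letters come from 00100.
seed : Stage 0
seed = record
  { L₀     = L
  ; L      = u ++ L
  ; m      = 11
  ; chain  = blocks⇒chain u (from-yes (blocks? u L))
  ; sparse = from-no (factor? 𝔹._≟_ OneOne ((u ++ L) ++ B))
  ; rich   = from-yes (stepRich? 𝔹._≟_ (L ++ C))
  ; large  = s≤s z≤n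
  -- Equality holds: 2 · 52 + 4 = 108 = 9 · 12.
  ; ratio  = ≤-refl
  }
  where
  L u : List Bool
  L = ψ (𝟙 ∷ 𝟘 ∷ 𝟘 ∷ 𝟘 ∷ 𝟘 ∷ 𝟙 ∷ 𝟘 ∷ 𝟘 ∷ 𝟙 ∷ 𝟘 ∷ 𝟘 ∷ 𝟘 ∷ 𝟙 ∷ 𝟘 ∷ 𝟘 ∷ 𝟘 ∷ 𝟙 ∷ 𝟘 ∷ 𝟙 ∷ [])
  u = τ (𝟘 ∷ 𝟘 ∷ 𝟙 ∷ 𝟘 ∷ 𝟘 ∷ []) ∷ʳ 𝟘

stage : ∀ k → Stage k
stage zero    = seed
stage (suc k) = next (stage k)

-- Larger alphabets

data Forced {A : Set} (w : List A) : ℕ → List A → Set where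
  start : Forced w 0 w
  step  : ∀ {m v x} → Forced w m v → (∀ y → y ≢ x → ¬ New y v) → Forced w (suc m) (x ∷ v)

module _ {A : Set} (_≟_ : DecidableEquality A) where

  forced-unique : ∀ {w : List A} {m v} → Forced w m v → ∀ u → StepRich (u ++ w) → length u ≡ m → u ++ w ≡ v
  forced-unique start          []      _       _   = refl
  forced-unique (step {x = x} F blocked) (y ∷ u) (n , r) len with forced-unique F u r (suc-injective len) | y ≟ x
  ... | refl | yes refl = refl
  ... | refl | no y≢x   = ⊥-elim (blocked y y≢x n)

  -- A shorter extension would stop inside the forced stretch, where one of two distinct letters
  -- differs from the forced one.
  forced-bound : ∀ {w : List A} {m v} → Forced w m v → ∀ u → StepRich (u ++ w) → Extendable (u ++ w) → m ≤ length u
  forced-bound start          u _ _ = z≤n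
  forced-bound (step {m} {x = x} F blocked) u r e@(y , z , y≢z , (ny , _) , (nz , _))
    with m≤n⇒m<n∨m≡n (forced-bound F u r e)
  ... | inj₁ m<u = m<u
  ... | inj₂ m≡u with refl ← forced-unique F u r (sym m≡u) | y ≟ x
  ...   | no y≢x   = ⊥-elim (blocked y y≢x ny)
  ...   | yes refl = ⊥-elim (blocked z (y≢z ∘ sym) nz)

unique⇒stepRich : ∀ {A : Set} {w : List A} → Unique w → StepRich w
unique⇒stepRich []                    = tt
unique⇒stepRich {w = x ∷ w} (x∉w ∷ u) =
  ([ x ] , refl , (w , refl) , λ f → case factor-split f of λ where
    (α , β , refl) → All.lookup x∉w (∈-++⁺ʳ α (here refl)) refl)
  , unique⇒stepRich u

∷-as-∷ʳ : ∀ {A : Set} (x : A) w → ∃[ w′ ] ∃[ y ] x ∷ w ≡ w′ ∷ʳ y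
∷-as-∷ʳ x []      = [] , x , refl
∷-as-∷ʳ x (y ∷ w) with w′ , z , eq ← ∷-as-∷ʳ y w = x ∷ w′ , z , cong (x ∷_) eq

-- The word v over {0, 1} becomes the word map g v ++ rest, whose oldest part
-- lists the letters of A that g omits.
module Embed {A : Set} (g : Bool → A) (g-injective : Injective _≡_ _≡_ g)
  (rest : List A) (disjoint : ∀ y → g y ∉ rest) (rest-unique : Unique rest)
  (cover : ∀ z → (∃[ y ] z ≡ g y) ⊎ z ∈ rest) where

  embed : List Bool → List A
  embed v = map g v ++ rest

  prefix-embed⁻ : ∀ v q {β} → embed v ≡ map g q ++ β → q ≼ v
  prefix-embed⁻ v       []      _  = v , refl
  prefix-embed⁻ []      (y ∷ q) eq = ⊥-elim (disjoint y (subst (g y ∈_) (sym eq) (here refl)))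
  prefix-embed⁻ (x ∷ v) (y ∷ q) eq with e , eq′ ← ∷-injective eq with r , e′ ← prefix-embed⁻ v q eq′ =
    r , cong₂ _∷_ (g-injective e) e′

  factor-embed⁻ : ∀ v q α {β} → embed v ≡ α ++ map g q ++ β → Factor q v
  factor-embed⁻ v       q       []      eq = ≼⇒Factor (prefix-embed⁻ v q eq)
  factor-embed⁻ (x ∷ v) q       (_ ∷ α) eq = there (factor-embed⁻ v q α (∷-injectiveʳ eq))
  factor-embed⁻ []      []      (_ ∷ α) eq = factor [] [] []
  factor-embed⁻ []      (y ∷ q) (c ∷ α) eq =
    ⊥-elim (disjoint y (subst (g y ∈_) (sym eq) (∈-++⁺ʳ (c ∷ α) (here refl))))

  factor-embed : ∀ {q v} → Factor q v → Factor (map g q) (embed v)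
  factor-embed {q} {v} f with α , β , refl ← factor-split f =
    subst (Factor (map g q)) (sym (cong (_++ rest) (trans (map-++ g α (q ++ β)) (cong (map g α ++_) (map-++ g q β)))))
      (factor (map g α) (map g q) (map g β) ⁱ++ rest)

  palindrome-map : ∀ {q} → Palindrome q → Palindrome (map g q)
  palindrome-map {q} pq = trans (sym (reverse-map g q)) (cong (map g) pq)

  palindrome-map⁻ : ∀ {q} → Palindrome (map g q) → Palindrome q
  palindrome-map⁻ {q} pq = map-injective g-injective (trans (reverse-map g q) pq)

  split-map : ∀ v q {δ} → map g v ≡ q ++ δ → ∃[ q′ ] (q′ ≼ v × q ≡ map g q′)
  split-map v       []      _  = [] , (v , refl) , refl
  split-map (x ∷ v) (_ ∷ q) eq with refl , eq′ ← ∷-injective eq with q′ , (r , e) , e′ ← split-map v q eq′ =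
    x ∷ q′ , (r , cong (x ∷_) e) , cong (g x ∷_) e′

  -- The distinct letters of `rest` are new palindromes themselves. Afterwards the new palindromes
  -- of `v` stay new, since their letters do not occur in `rest`.
  stepRich-embed : ∀ v → StepRich v → StepRich (embed v)
  stepRich-embed []      _ = unique⇒stepRich rest-unique
  stepRich-embed (x ∷ v) ((q , pq , (s , eq) , ¬f) , r) =
    (map g q , palindrome-map pq
      , (map g s ++ rest , trans (cong embed eq) (trans (cong (_++ rest) (map-++ g q s)) (++-assoc (map g q) (map g s) rest)))
      , λ f → let α , β , e = factor-split f in ¬f (factor-embed⁻ v q α e))
    , stepRich-embed v r

  last-∈ : ∀ {c δ s} → rest ≡ c ∷ δ ++ s → ∃[ δ′ ] ∃[ d ] (c ∷ δ ≡ δ′ ∷ʳ d × d ∈ rest × (∀ {y} → y ∈ δ′ → y ∈ rest))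
  last-∈ {c} {δ} {s} eq with δ′ , d , e ← ∷-as-∷ʳ c δ = δ′ , d , e
    , subst (d ∈_) (sym (rest≡ e)) (∈-++⁺ˡ (∈-++⁺ʳ δ′ (here refl)))
    , λ y∈ → subst (_ ∈_) (sym (rest≡ e)) (∈-++⁺ˡ (∈-++⁺ˡ y∈))
    where
    rest≡ : ∀ {ζ} → c ∷ δ ≡ ζ → rest ≡ ζ ++ s
    rest≡ e = trans eq (cong (_++ s) e)

  -- A palindrome reaching into `rest` would begin with `g y` and end with a letter of `rest`.
  blocked-embed : ∀ {y v} → ¬ New y v → ¬ New (g y) (embed v)
  blocked-embed {y} {v} ¬new (q , pq , (s , eq) , ¬f) with ++-split q (map g (y ∷ v)) (sym eq)
  ... | inj₁ (δ , e , _) with q′ , q′≼ , refl ← split-map (y ∷ v) q e =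
    ¬f (factor-embed (decidable-stable (factor? 𝔹._≟_ q′ v) λ ¬f′ → ¬new (q′ , palindrome-map⁻ pq , q′≼ , ¬f′)))
  ... | inj₂ (c , δ , q≡ , e) with δ′ , d , e′ , d∈ , _ ← last-∈ e =
    disjoint y (subst (_∈ rest) (sym (palindrome-ends (subst Palindrome q≡′ pq))) d∈)
    where
    q≡′ : q ≡ g y ∷ (map g v ++ δ′) ∷ʳ d
    q≡′ = trans q≡ (cong (g y ∷_) (trans (cong (map g v ++_) e′) (sym (++-assoc (map g v) δ′ [ d ]))))

  -- A longer palindrome than `[ z ]` must end in `rest`. Without its ends it is `map g v`, which is
  -- no palindrome, or it begins in the range of `g` and ends in `rest`.
  blocked-rest : ∀ {z v} → z ∈ rest → ¬ Palindrome v → ¬ New z (embed v)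
  blocked-rest {z} {v} z∈ ¬pal ([]    , pq , (s , eq) , ¬f) = ¬f (factor [] [] _)
  blocked-rest {z} {v} z∈ ¬pal (_ ∷ q , pq , (s , eq) , ¬f) with refl , eq′ ← ∷-injective eq
    with ++-split q (map g v) (sym eq′)
  blocked-rest {z} {v} z∈ ¬pal (_ ∷ q , pq , (s , eq) , ¬f) | inj₁ (δ , e , _)
    with q′ , _ , refl ← split-map v q e with initLast q′
  ... | []       = ¬f (map g v ++ⁱ member z∈)
    where
    member : ∀ {w} → z ∈ w → Factor [ z ] w
    member (here z≡) = here (z≡ Prefix.∷ Prefix.[])
    member (there z∈) = there (member z∈)
  ... | q″ ∷ʳ′ y = disjoint y (subst (_∈ rest) (palindrome-ends (subst (λ u → Palindrome (z ∷ u)) (map-++ g q″ [ y ]) pq)) z∈)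
  blocked-rest {z} {v} z∈ ¬pal (_ ∷ q , pq , (s , eq) , ¬f) | inj₂ (c , δ , q≡ , e)
    with δ′ , d , e′ , d∈ , δ′⊆ ← last-∈ e = no-inner v ¬pal δ′ δ′⊆
      (palindrome-wrap⁻ (subst (λ u → Palindrome (z ∷ u)) q≡′ pq))
    where
    q≡′ : q ≡ (map g v ++ δ′) ∷ʳ d
    q≡′ = trans q≡ (trans (cong (map g v ++_) e′) (sym (++-assoc (map g v) δ′ [ d ])))
    no-inner : ∀ v → ¬ Palindrome v → ∀ δ → (∀ {y} → y ∈ δ → y ∈ rest) → ¬ Palindrome (map g v ++ δ)
    no-inner v ¬pal δ δ⊆ pal with initLast δ
    no-inner v ¬pal _ δ⊆ pal | [] = ¬pal (palindrome-map⁻ (subst Palindrome (++-identityʳ (map g v)) pal))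
    no-inner []      ¬pal _ δ⊆ pal | _ ∷ʳ′ _ = ¬pal refl
    no-inner (y ∷ v) ¬pal _ δ⊆ pal | δ ∷ʳ′ d = disjoint y (subst (_∈ rest)
      (sym (palindrome-ends (subst (λ u → Palindrome (g y ∷ u)) (sym (++-assoc (map g v) δ [ d ])) pal))) (δ⊆ (∈-++⁺ʳ δ (here refl))))

  chain⇒forced : ∀ {L₀ m L} → Chain L₀ m L → Sparse (L ++ B) → Forced (embed (L₀ ++ C)) m (embed (L ++ C))
  chain⇒forced start                      _      = start
  chain⇒forced (step {x = x} {L} c ¬new) sparse = step (chain⇒forced c (sparse ∘ there)) blocked
    where
    blocked : ∀ z → z ≢ g x → ¬ New z (embed (L ++ C))
    blocked z z≢ with cover z
    ... | inj₂ z∈         = blocked-rest z∈ (sparse⇒¬palindrome L (sparse ∘ there))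
    ... | inj₁ (y , refl) = blocked-embed (subst (λ y → ¬ New y (L ++ C)) (sym (𝔹.¬-not (z≢ ∘ cong g))) ¬new)

-- The inequality over the reals and the conclusion

scale-≤ : ∀ n p → 2 * n ≤ 9 * p → (+ 2 / 9) ℚ.* (+ n / 1) ℚ.≤ + p / 1
scale-≤ n p le = ℚ.toℚᵘ-cancel-≤ (begin
  toℚᵘ ((+ 2 / 9) ℚ.* (+ n / 1))           ≃⟨ ℚ.toℚᵘ-homo-* (+ 2 / 9) (+ n / 1) ⟩
  toℚᵘ (+ 2 / 9) ℚᵘ.* toℚᵘ (+ n / 1)       ≃⟨ ℚᵘ.*-congˡ {toℚᵘ (+ 2 / 9)} (ℚ.toℚᵘ-fromℚᵘ (ℚᵘ.mkℚᵘ (+ n) 0)) ⟩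
  ℚᵘ.mkℚᵘ (+ 2) 8 ℚᵘ.* ℚᵘ.mkℚᵘ (+ n) 0     ≤⟨ ℚᵘ.*≤* integral ⟩
  ℚᵘ.mkℚᵘ (+ p) 0                          ≃⟨ ℚ.toℚᵘ-fromℚᵘ (ℚᵘ.mkℚᵘ (+ p) 0) ⟨
  toℚᵘ (+ p / 1)                           ∎)
  where
  integral : (+ 2 ℤ.* + n) ℤ.* + 1 ℤ.≤ + p ℤ.* + 9
  integral = subst₂ ℤ._≤_
    (trans (ℤ.pos-* 2 n) (sym (ℤ.*-identityʳ (+ 2 ℤ.* + n))))
    (trans (cong +_ (*-comm 9 p)) (ℤ.pos-* p 9)) (ℤ.+≤+ le)
  open ℚᵘ.≤-Reasoning

-- From the index `N` on, the terms of `c` are at least the positive `δ`, so dropping them only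
-- enlarges the left side.
scaleℝ-≤ : ∀ c → 0ℝ <ℝ c → ∀ n p → 2 * n ≤ 9 * p → (fromℚ (+ 2 / 9) -ℝ c) *ℝ fromℕ n ≤ℝ fromℕ p
scaleℝ-≤ c (δ , 0<δ , N , c≥δ) n p le ε 0<ε = N , λ i N≤i →
  let 0≤c : 0ℚ ℚ.≤ seq c i
      0≤c = ℚ.≤-trans (ℚ.≤-trans (ℚ.<⇒≤ 0<δ) (ℚ.≤-reflexive (sym (ℚ.+-identityˡ δ)))) (c≥δ i N≤i)
  in begin
    ((+ 2 / 9) ℚ.- seq c i) ℚ.* (+ n / 1)  ≤⟨ ℚ.*-monoʳ-≤-nonNeg (+ n / 1) {{ℚ.normalize-nonNeg n 1}} (begin
        (+ 2 / 9) ℚ.- seq c i              ≤⟨ ℚ.+-monoʳ-≤ (+ 2 / 9) (ℚ.neg-antimono-≤ 0≤c) ⟩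
        (+ 2 / 9) ℚ.+ 0ℚ                   ≡⟨ ℚ.+-identityʳ (+ 2 / 9) ⟩
        + 2 / 9                            ∎) ⟩
    (+ 2 / 9) ℚ.* (+ n / 1)                ≤⟨ scale-≤ n p le ⟩
    + p / 1                                ≡⟨ ℚ.+-identityʳ (+ p / 1) ⟨
    + p / 1 ℚ.+ 0ℚ                         ≤⟨ ℚ.+-monoʳ-≤ (+ p / 1) (ℚ.<⇒≤ 0<ε) ⟩
    + p / 1 ℚ.+ ε                          ∎
  where open ℚ.≤-Reasoning

corollary6p12 : (A : Set) (a : ℕ) → A ↔ Fin a → 2 ≤ a →
    (c : ℝ) → 0ℝ <ℝ c →
    (m : ℕ) → 0 < m →
    ∃[ n ] (m < n × ∃[ p ] (φ A n p × (fromℚ (+ 2 / 9) -ℝ c) *ℝ fromℕ n ≤ℝ fromℕ p))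
corollary6p12 A (suc (suc r)) A↔Fin (s≤s (s≤s z≤n)) c 0<c m 0<m =
  conclude (φ-bound {from zero} {from (suc zero)} (λ e → case from-injective e of λ ()) {w = reverse w}
      (stepRich-reverse⇒rich _≟_ (subst StepRich (sym (reverse-involutive w)) (stepRich-embed _ rich))) bound)
  where
  open Inverse A↔Fin
  open Finite A↔Fin

  from-injective : Injective _≡_ _≡_ from
  from-injective {x} {y} e = trans (sym (strictlyInverseˡ x)) (trans (cong to e) (strictlyInverseˡ y))

  digit : Bool → Fin (suc (suc r))
  digit 𝟘 = zero
  digit 𝟙 = suc zero

  digit-injective : Injective _≡_ _≡_ digit
  digit-injective {𝟘} {𝟘} _ = refl
  digit-injective {𝟙} {𝟙} _ = refl

  other : Fin r → A
  other i = from (suc (suc i))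

  rest : List A
  rest = map other (allFin r)

  disjoint : ∀ y → from (digit y) ∉ rest
  disjoint y y∈ with i , _ , e ← ∈-map⁻ other y∈ = differ y (from-injective e)
    where
    differ : ∀ y → digit y ≢ suc (suc i)
    differ 𝟘 ()
    differ 𝟙 ()

  cover : ∀ z → (∃[ y ] z ≡ from (digit y)) ⊎ z ∈ rest
  cover z = subst (λ z → (∃[ y ] z ≡ from (digit y)) ⊎ z ∈ rest) (strictlyInverseʳ z) (index (to z))
    where
    index : ∀ i → (∃[ y ] from i ≡ from (digit y)) ⊎ from i ∈ rest
    index zero          = inj₁ (𝟘 , refl)
    index (suc zero)    = inj₁ (𝟙 , refl)
    index (suc (suc i)) = inj₂ (∈-map⁺ other (∈-allFin i))

  open Embed (from ∘ digit) (digit-injective ∘ from-injective) rest disjoint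
    (Unique.map⁺ (λ e → Fin.suc-injective (Fin.suc-injective (from-injective e))) (Unique.allFin⁺ r)) cover
  -- The `m` makes the word long enough, and the `r` pays for the letters of `rest`.
  open Stage (stage (m + r)) renaming (m to l)

  w : List A
  w = embed (L₀ ++ C)

  bound : ∀ {u} → K (reverse w) u → l ≤ length u
  bound {u} k = ≤-trans (forced-bound _≟_ (chain⇒forced chain sparse) (reverse u)
      (subst StepRich eq (rich⇒stepRich-reverse _≟_ (proj₁ k)))
      (subst Extendable eq (K⇒extendable _≟_ {reverse w} {u} k)))
    (≤-reflexive (length-reverse u))
    where
    eq : reverse (reverse w ++ u) ≡ reverse u ++ w
    eq = trans (reverse-++ (reverse w) u) (cong (reverse u ++_) (reverse-involutive w))

  n : ℕ
  n = length (L₀ ++ C)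

  length-w : length (reverse w) ≡ n + r
  length-w = trans (length-reverse w) (trans (length-++ (map _ (L₀ ++ C)))
    (cong₂ _+_ (length-map _ (L₀ ++ C)) (trans (length-map other (allFin r)) (length-tabulate {n = r} (λ i → i)))))

  large′ : m < length (reverse w)
  large′ = ≤-trans (s≤s (m≤m+n m r)) (≤-trans large (≤-trans (m≤m+n n r) (≤-reflexive (sym length-w))))

  ratio′ : 2 * length (reverse w) ≤ 9 * l
  -- The summand 2(m + r) of `ratio` covers the 2r due to `rest`, and the constant 2 · 5 + 4 exceeds
  -- the 9 by which `9 * suc l` is larger than `9 * l`.
  ratio′ = +-cancelʳ-≤ 9 _ _ (begin
    2 * length (reverse w) + 9              ≡⟨ cong (λ k → 2 * k + 9) length-w ⟩
    2 * (n + r) + 9                         ≤⟨ m≤m+n _ (5 + 2 * m) ⟩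
    2 * (n + r) + 9 + (5 + 2 * m)           ≡⟨ regroup n r m ⟩
    2 * (n + 5) + (4 + 2 * (m + r))         ≤⟨ ratio ⟩
    9 * suc l                               ≡⟨ trans (*-suc 9 l) (+-comm 9 (9 * l)) ⟩
    9 * l + 9                               ∎)
    where
    open ≤-Reasoning
    regroup : ∀ n r m → 2 * (n + r) + 9 + (5 + 2 * m) ≡ 2 * (n + 5) + (4 + 2 * (m + r))
    regroup = solve-∀

  conclude : ∃[ p ] (φ A (length (reverse w)) p × l ≤ p) → _
  conclude (p , φp , l≤p) =
    length (reverse w) , large′ , p , φp , scaleℝ-≤ c 0<c (length (reverse w)) p (≤-trans ratio′ (*-monoʳ-≤ 9 l≤p))
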